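{- Let $G$ be a simple game with $n$ players and $N=(n+1)2^{\frac{1}{2}n\log_2 n}$. The following two statements are equivalent, and $G$ is roughly weighted if and only if they hold: (a) for no positive integer $j\le N$ does there exist a potent certificate of non-weightedness of length $j$; (b) for no positive integer $j\le N$ do there exist $j$ vectors $\mathbf{v}_1,\dots,\mathbf{v}_j\in I(G)$ with $\mathbf{v}_1+\dots+\mathbf{v}_j+\mathbf{1}=\mathbf{0}$, where $\mathbf{1}=(1,\dots,1)$.
   Context: A simple game is $G=(P,W)$ with $P=[n]$, $W\subseteq 2^P$ (winning coalitions) closed under supersets within $P$, $W\ne\emptyset$, $W\ne 2^P$; $L=2^P\setminus W$ are the losing coalitions. $G$ is roughly weighted if there exist non-negative reals $w_1,\dots,w_n$ and a real $q$, not all equal to zero, such that $\sum_{i\in X}w_i<q$ implies $X\in L$ and $\sum_{i\in X}w_i>q$ implies $X\in W$. For $X,Y\subseteq[n]$, $\mathbf{v}_{X,Y}=\chi(X)-\chi(Y)$ with $\chi$ the characteristic vector, and $I(G)=\{\mathbf{v}_{X,Y}: X\in W, Y\in L\}$. A trading transform of length $j$ is $(X_1,\dots,X_j;Y_1,\dots,Y_j)$ with every player belonging to equally many $X_i$'s as $Y_i$'s; it is a certificate of non-weightedness if all $X_i$ are winning and all $Y_i$ losing; it is potent if moreover the grand coalition $P$ is among the $X_i$ and $\emptyset$ is among the $Y_i$.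
   Formalization: The weights and the quota in the definition of "roughly weighted" are rational numbers instead of real numbers. -}

module Defs where

open import Data.Bool using (Bool; true; false; if_then_else_)
open import Data.Nat as ℕ using (ℕ; zero; suc)
open import Data.Fin using (Fin)
open import Data.Vec using (Vec; []; _∷_; map; zipWith; replicate; foldr; lookup)
open import Data.Vec.Relation.Unary.All using (All)
open import Data.Fin.Subset using (Subset; _⊆_) renaming (⊤ to fullSet; ⊥ to emptySet)
open import Data.Integer as ℤ using (ℤ)
open import Data.Rational as ℚ using (ℚ)
open import Data.Product using (Σ; ∃; ∃-syntax; _×_)
open import Data.Sum using (_⊎_)
open import Relation.Binary.PropositionalEquality using (_≡_; _≢_)
open import Relation.Nullary using (¬_)

record SimpleGame (n : ℕ) : Set where
  field
    winning   : Subset n → Bool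
    monotone  : ∀ X Y → X ⊆ Y → winning X ≡ true → winning Y ≡ true
    someWin   : ∃[ X ] winning X ≡ true
    someLose  : ∃[ Y ] winning Y ≡ false
open SimpleGame public

Winning : ∀ {n} → SimpleGame n → Subset n → Set
Winning G X = winning G X ≡ true

Losing : ∀ {n} → SimpleGame n → Subset n → Set
Losing G X = winning G X ≡ false

occ : ∀ {n j} → Fin n → Vec (Subset n) j → ℕ
occ i [] = 0
occ i (X ∷ Xs) = (if lookup X i then 1 else 0) ℕ.+ occ i Xs

IsTradingTransform : ∀ {n j} → Vec (Subset n) j → Vec (Subset n) j → Set
IsTradingTransform Xs Ys = ∀ i → occ i Xs ≡ occ i Ys

IsCertificate : ∀ {n j} → SimpleGame n → Vec (Subset n) j → Vec (Subset n) j → Set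
IsCertificate G Xs Ys =
  IsTradingTransform Xs Ys × All (Winning G) Xs × All (Losing G) Ys

IsPotentCertificate : ∀ {n j} → SimpleGame n → Vec (Subset n) j → Vec (Subset n) j → Set
IsPotentCertificate G Xs Ys =
  IsCertificate G Xs Ys × (∃[ k ] lookup Xs k ≡ fullSet) × (∃[ k ] lookup Ys k ≡ emptySet)

χ : ∀ {n} → Subset n → Vec ℤ n
χ = map (λ b → if b then ℤ.1ℤ else ℤ.0ℤ)

vec : ∀ {n} → Subset n → Subset n → Vec ℤ n
vec X Y = zipWith ℤ._-_ (χ X) (χ Y)

InI : ∀ {n} → SimpleGame n → Vec ℤ n → Set
InI G v = ∃[ X ] ∃[ Y ] Winning G X × Losing G Y × v ≡ vec X Y

vsum : ∀ {n j} → Vec (Vec ℤ n) j → Vec ℤ n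
vsum = foldr _ (zipWith ℤ._+_) (replicate _ ℤ.0ℤ)

weight : ∀ {n} → Vec ℚ n → Subset n → ℚ
weight [] [] = ℚ.0ℚ
weight (w ∷ ws) (b ∷ X) = (if b then w else ℚ.0ℚ) ℚ.+ weight ws X

RoughlyWeighted : ∀ {n} → SimpleGame n → Set
RoughlyWeighted {n} G =
  Σ (Vec ℚ n) λ w → Σ ℚ λ q →
    All (ℚ.0ℚ ℚ.≤_) w
    × ((∃[ i ] lookup w i ≢ ℚ.0ℚ) ⊎ q ≢ ℚ.0ℚ)
    × (∀ X → weight w X ℚ.< q → Losing G X)
    × (∀ X → q ℚ.< weight w X → Winning G X)

-- j ≤ N = (n+1) 2^{(1/2) n log₂ n} = (n+1) n^{n/2}  ⇔  j² ≤ (n+1)² nⁿ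
WithinBound : ℕ → ℕ → Set
WithinBound n j = j ℕ.* j ℕ.≤ (suc n ℕ.* suc n) ℕ.* (n ℕ.^ n)

ConditionA : ∀ {n} → SimpleGame n → Set
ConditionA {n} G = ∀ j → 1 ℕ.≤ j → WithinBound n j →
  ¬ (Σ (Vec (Subset n) j) λ Xs → Σ (Vec (Subset n) j) λ Ys → IsPotentCertificate G Xs Ys)

ConditionB : ∀ {n} → SimpleGame n → Set
ConditionB {n} G = ∀ j → 1 ℕ.≤ j → WithinBound n j →
  ¬ (Σ (Vec (Vec ℤ n) j) λ vs →
       All (InI G) vs × zipWith ℤ._+_ (vsum vs) (replicate n ℤ.1ℤ) ≡ replicate n ℤ.0ℤ)

{-# OPTIONS --safe #-}

-- The game G is roughly weighted iff some w ≥ 0, w ≠ 0 satisfies w · v ≥ 0 for all v ∈ I(G); then q is the least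
-- weight of a winning coalition.  Otherwise, by Farkas' lemma, D (−1) is a nonnegative combination of linearly
-- independent vectors b₁, …, b_k taken from I(G) and the unit vectors, with D > 0.  By Cramer's rule D and the
-- coefficients may be taken to be coordinates of b₁ ∧ … ∧ b_k and of the same product with b_i replaced by −1.  All
-- vectors involved have norm at most √n, so Hadamard's inequality bounds the coefficients by n^(n/2), and the vectors
-- of I(G) occurring, counted with multiplicity, number at most n · n^(n/2) < N.  Their sum is at most −1 in every
-- coordinate; removing players from the losing coalitions makes it exactly −1.  This refutes (b), and adjoining the
-- pair (P, ∅) refutes (a).  Conversely, a potent certificate of any length forces P to weigh no more than ∅.
module Submission where

open import Defs
open import Algebra.Bundles using (CommutativeMonoid)
open import Axiom.UniquenessOfIdentityProofs.WithK using (uip)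
open import Data.Bool as Bool using (Bool; true; false; if_then_else_)
open import Data.Empty using (⊥; ⊥-elim)
open import Data.Fin using (Fin; zero; suc)
open import Data.Fin.Subset using (Subset; _⊆_) renaming (⊤ to fullSet; ⊥ to emptySet; ∣_∣ to ∣_∣ₛ)
open import Data.Fin.Subset.Properties using (∣p∣≤n; ⊆-max; ⊆-min)
open import Data.Integer using (ℤ; +_; -[1+_]; 0ℤ; 1ℤ; -1ℤ; _+_; _*_; -_; _-_; _≤_; _<_; ∣_∣; +<+; +≤+; NonZero; nonNegative; positive; >-nonZero)
import Data.Integer.Properties as ℤₚ
open import Data.Integer.Tactic.RingSolver using (solve-∀)
open import Data.List as List using (List; []; _∷_; _++_)
open import Data.List.Extrema ℤₚ.≤-totalOrder using (argmin; f[argmin]≤f[xs])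
open import Data.List.Membership.Propositional using (_∈_)
open import Data.List.Membership.Propositional.Properties using (∈-∃++; ∈-map⁺; ∈-++⁺ˡ; ∈-++⁺ʳ; ∈-cartesianProduct⁺; ∈-allFin)
import Data.List.Properties as Listₚ
open import Data.List.Relation.Unary.All as All using (All; []; _∷_)
import Data.List.Relation.Unary.All.Properties as Allₚ
open import Data.List.Relation.Unary.Any using (here; there)
open import Data.Nat as ℕ using (ℕ; zero; suc; z≤n; s≤s)
open import Data.Nat.ListAction using (sum)
import Data.Nat.Properties as ℕₚ
open import Data.Product using (Σ; ∃-syntax; _×_; _,_; proj₁; proj₂; map₁)
open import Data.Rational as ℚ using (ℚ; 0ℚ)
open import Data.Rational.Literals using (fromℤ)
import Data.Rational.Properties as ℚₚ
import Data.Rational.Unnormalised as ℚᵘ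
import Data.Rational.Unnormalised.Properties as ℚᵘₚ
open import Data.Sum using (_⊎_; inj₁; inj₂)
open import Data.Vec as Vec using (Vec; []; _∷_; replicate; lookup; tabulate)
import Data.Vec.Properties as Vecₚ
import Data.Vec.Relation.Unary.All as VecAll
import Data.Vec.Relation.Unary.All.Properties as VecAllₚ
open import Function using (_∘_; flip)
open import Function.Bundles using (_⇔_; mk⇔)
open import Relation.Binary.PropositionalEquality
open import Relation.Nullary using (¬_; yes; no)

open import Algebra.Definitions.RawMonoid ℚ.+-0-rawMonoid using () renaming (_×_ to _·_)
open import Algebra.Properties.CommutativeSemigroup (CommutativeMonoid.commutativeSemigroup ℚₚ.+-0-commutativeMonoid) using (interchange; x∙yz≈y∙xz)
open VecAll using ([]; _∷_)
open ≡-Reasoning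

private variable
  n : ℕ
  A : Set

-- Exterior algebra of ℤⁿ

square-nonneg : (i : ℤ) → 0ℤ ≤ i * i
square-nonneg (+ m) = subst (0ℤ ≤_) (ℤₚ.pos-* m m) (+≤+ z≤n)
square-nonneg -[1+ m ] = +≤+ z≤n

-- ω S is the coefficient of the product of the basis vectors indexed by S, in increasing order.
Form : ℕ → Set
Form n = Subset n → ℤ

dot : Vec ℤ n → Vec ℤ n → ℤ
dot [] [] = 0ℤ
dot (x ∷ u) (y ∷ v) = x * y + dot u v

infixl 6 _⊞_
infixr 7 _⊡_

_⊞_ : Vec ℤ n → Vec ℤ n → Vec ℤ n
_⊞_ = Vec.zipWith _+_

_⊡_ : ℤ → Vec ℤ n → Vec ℤ n
s ⊡ v = Vec.map (s *_) v

dot-comm : (u v : Vec ℤ n) → dot u v ≡ dot v u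
dot-comm [] [] = refl
dot-comm (x ∷ u) (y ∷ v) = cong₂ _+_ (ℤₚ.*-comm x y) (dot-comm u v)

dot-⊞ : (w u v : Vec ℤ n) → dot w (u ⊞ v) ≡ dot w u + dot w v
dot-⊞ [] [] [] = refl
dot-⊞ (z ∷ w) (x ∷ u) (y ∷ v) rewrite dot-⊞ w u v = ring z x y (dot w u) (dot w v)
  where
  ring : ∀ z x y p q → z * (x + y) + (p + q) ≡ z * x + p + (z * y + q)
  ring = solve-∀

dot-⊡ : (w : Vec ℤ n) (s : ℤ) (v : Vec ℤ n) → dot w (s ⊡ v) ≡ s * dot w v
dot-⊡ [] s [] = sym (ℤₚ.*-zeroʳ s)
dot-⊡ (z ∷ w) s (y ∷ v) rewrite dot-⊡ w s v = ring z s y (dot w v)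
  where
  ring : ∀ z s y p → z * (s * y) + s * p ≡ s * (z * y + p)
  ring = solve-∀

one : Form n
one [] = 1ℤ
one (false ∷ S) = one S
one (true ∷ S) = 0ℤ

-- Left multiplication by a vector in the exterior algebra. The minus sign comes from moving the
-- tail `v` past the first basis vector.
wedge : Vec ℤ n → Form n → Form n
wedge [] ω S = 0ℤ
wedge (x ∷ v) ω (false ∷ S) = wedge v (ω ∘ (false ∷_)) S
wedge (x ∷ v) ω (true ∷ S) = x * ω (false ∷ S) - wedge v (ω ∘ (true ∷_)) S

-- The interior product with a vector, the transpose of `wedge`. Being an antiderivation, it changes
-- sign when it passes the first basis vector.
contract : Vec ℤ n → Form n → Form n
contract [] ω S = 0ℤ
contract (x ∷ v) ω (false ∷ S) = contract v (ω ∘ (false ∷_)) S + x * ω (true ∷ S)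
contract (x ∷ v) ω (true ∷ S) = - contract v (ω ∘ (true ∷_)) S

wedge-cong : (v : Vec ℤ n) {ω η : Form n} → ω ≗ η → wedge v ω ≗ wedge v η
wedge-cong [] e S = refl
wedge-cong (x ∷ v) e (false ∷ S) = wedge-cong v (e ∘ (false ∷_)) S
wedge-cong (x ∷ v) e (true ∷ S) =
  cong₂ _-_ (cong (x *_) (e (false ∷ S))) (wedge-cong v (e ∘ (true ∷_)) S)

contract-cong : (v : Vec ℤ n) {ω η : Form n} → ω ≗ η → contract v ω ≗ contract v η
contract-cong [] e S = refl
contract-cong (x ∷ v) e (false ∷ S) =
  cong₂ _+_ (contract-cong v (e ∘ (false ∷_)) S) (cong (x *_) (e (true ∷ S)))
contract-cong (x ∷ v) e (true ∷ S) = cong -_ (contract-cong v (e ∘ (true ∷_)) S)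

wedge-linear : (v : Vec ℤ n) (a b : ℤ) (ω η : Form n) →
  ∀ S → wedge v (λ T → a * ω T + b * η T) S ≡ a * wedge v ω S + b * wedge v η S
wedge-linear [] a b ω η S = ring a b
  where
  ring : ∀ a b → 0ℤ ≡ a * 0ℤ + b * 0ℤ
  ring = solve-∀
wedge-linear (x ∷ v) a b ω η (false ∷ S) = wedge-linear v a b _ _ S
wedge-linear (x ∷ v) a b ω η (true ∷ S)
  rewrite wedge-linear v a b (ω ∘ (true ∷_)) (η ∘ (true ∷_)) S =
  ring x a b (ω (false ∷ S)) (η (false ∷ S)) (wedge v (ω ∘ (true ∷_)) S) (wedge v (η ∘ (true ∷_)) S)
  where
  ring : ∀ x a b p q r s → x * (a * p + b * q) - (a * r + b * s) ≡ a * (x * p - r) + b * (x * q - s)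
  ring = solve-∀

contract-linear : (v : Vec ℤ n) (a b : ℤ) (ω η : Form n) →
  ∀ S → contract v (λ T → a * ω T + b * η T) S ≡ a * contract v ω S + b * contract v η S
contract-linear [] a b ω η S = ring a b
  where
  ring : ∀ a b → 0ℤ ≡ a * 0ℤ + b * 0ℤ
  ring = solve-∀
contract-linear (x ∷ v) a b ω η (false ∷ S)
  rewrite contract-linear v a b (ω ∘ (false ∷_)) (η ∘ (false ∷_)) S =
  ring x a b (ω (true ∷ S)) (η (true ∷ S)) (contract v (ω ∘ (false ∷_)) S) (contract v (η ∘ (false ∷_)) S)
  where
  ring : ∀ x a b p q r s → (a * r + b * s) + x * (a * p + b * q) ≡ a * (r + x * p) + b * (s + x * q)
  ring = solve-∀
contract-linear (x ∷ v) a b ω η (true ∷ S)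
  rewrite contract-linear v a b (ω ∘ (true ∷_)) (η ∘ (true ∷_)) S =
  ring a b (contract v (ω ∘ (true ∷_)) S) (contract v (η ∘ (true ∷_)) S)
  where
  ring : ∀ a b r s → - (a * r + b * s) ≡ a * - r + b * - s
  ring = solve-∀

wedge-sub : (v : Vec ℤ n) (x : ℤ) (ω η : Form n) →
  ∀ S → wedge v (λ T → x * ω T - η T) S ≡ x * wedge v ω S - wedge v η S
wedge-sub v x ω η S = begin
  wedge v (λ T → x * ω T - η T) S          ≡⟨ wedge-cong v (λ T → to x (ω T) (η T)) S ⟩
  wedge v (λ T → x * ω T + -1ℤ * η T) S    ≡⟨ wedge-linear v x -1ℤ ω η S ⟩
  x * wedge v ω S + -1ℤ * wedge v η S      ≡⟨ to x (wedge v ω S) (wedge v η S) ⟨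
  x * wedge v ω S - wedge v η S            ∎
  where
  to : ∀ x a b → x * a - b ≡ x * a + -1ℤ * b
  to = solve-∀

contract-sub : (v : Vec ℤ n) (x : ℤ) (ω η : Form n) →
  ∀ S → contract v (λ T → x * ω T - η T) S ≡ x * contract v ω S - contract v η S
contract-sub v x ω η S = begin
  contract v (λ T → x * ω T - η T) S             ≡⟨ contract-cong v (λ T → to x (ω T) (η T)) S ⟩
  contract v (λ T → x * ω T + -1ℤ * η T) S       ≡⟨ contract-linear v x -1ℤ ω η S ⟩
  x * contract v ω S + -1ℤ * contract v η S      ≡⟨ to x (contract v ω S) (contract v η S) ⟨
  x * contract v ω S - contract v η S            ∎
  where
  to : ∀ x a b → x * a - b ≡ x * a + -1ℤ * b
  to = solve-∀

wedge-scale : (v : Vec ℤ n) (a : ℤ) (ω : Form n) → ∀ S → wedge v (λ T → a * ω T) S ≡ a * wedge v ω S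
wedge-scale v a ω S = begin
  wedge v (λ T → a * ω T) S                ≡⟨ wedge-cong v (λ T → to a (ω T)) S ⟩
  wedge v (λ T → a * ω T + 0ℤ * ω T) S     ≡⟨ wedge-linear v a 0ℤ ω ω S ⟩
  a * wedge v ω S + 0ℤ * wedge v ω S       ≡⟨ to a (wedge v ω S) ⟨
  a * wedge v ω S                          ∎
  where
  to : ∀ a b → a * b ≡ a * b + 0ℤ * b
  to = solve-∀

wedge-0 : (v : Vec ℤ n) {ω : Form n} → (∀ S → ω S ≡ 0ℤ) → ∀ S → wedge v ω S ≡ 0ℤ
wedge-0 [] e S = refl
wedge-0 (x ∷ v) e (false ∷ S) = wedge-0 v (e ∘ (false ∷_)) S
wedge-0 (x ∷ v) e (true ∷ S)
  rewrite e (false ∷ S) | wedge-0 v (e ∘ (true ∷_)) S | ℤₚ.*-zeroʳ x = refl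

contract-0 : (v : Vec ℤ n) {ω : Form n} → (∀ S → ω S ≡ 0ℤ) → ∀ S → contract v ω S ≡ 0ℤ
contract-0 [] e S = refl
contract-0 (x ∷ v) e (false ∷ S)
  rewrite e (true ∷ S) | contract-0 v (e ∘ (false ∷_)) S | ℤₚ.*-zeroʳ x = refl
contract-0 (x ∷ v) e (true ∷ S) = cong -_ (contract-0 v (e ∘ (true ∷_)) S)

wedge-⊞ : (u v : Vec ℤ n) (ω : Form n) → ∀ S → wedge (u ⊞ v) ω S ≡ wedge u ω S + wedge v ω S
wedge-⊞ [] [] ω S = refl
wedge-⊞ (x ∷ u) (y ∷ v) ω (false ∷ S) = wedge-⊞ u v _ S
wedge-⊞ (x ∷ u) (y ∷ v) ω (true ∷ S) rewrite wedge-⊞ u v (ω ∘ (true ∷_)) S =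
  ring x y (ω (false ∷ S)) (wedge u (ω ∘ (true ∷_)) S) (wedge v (ω ∘ (true ∷_)) S)
  where
  ring : ∀ x y p q r → (x + y) * p - (q + r) ≡ x * p - q + (y * p - r)
  ring = solve-∀

wedge-⊡ : (s : ℤ) (v : Vec ℤ n) (ω : Form n) → ∀ S → wedge (s ⊡ v) ω S ≡ s * wedge v ω S
wedge-⊡ s [] ω S = sym (ℤₚ.*-zeroʳ s)
wedge-⊡ s (x ∷ v) ω (false ∷ S) = wedge-⊡ s v _ S
wedge-⊡ s (x ∷ v) ω (true ∷ S) rewrite wedge-⊡ s v (ω ∘ (true ∷_)) S =
  ring s x (ω (false ∷ S)) (wedge v (ω ∘ (true ∷_)) S)
  where
  ring : ∀ s x p q → s * x * p - s * q ≡ s * (x * p - q)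
  ring = solve-∀

wedge-anticomm : (u v : Vec ℤ n) (ω : Form n) → ∀ S → wedge u (wedge v ω) S ≡ - wedge v (wedge u ω) S
wedge-anticomm [] [] ω S = refl
wedge-anticomm (x ∷ u) (y ∷ v) ω (false ∷ S) = wedge-anticomm u v _ S
wedge-anticomm (x ∷ u) (y ∷ v) ω (true ∷ S)
  rewrite wedge-sub u y (ω ∘ (false ∷_)) (wedge v (ω ∘ (true ∷_))) S
        | wedge-sub v x (ω ∘ (false ∷_)) (wedge u (ω ∘ (true ∷_))) S
        | wedge-anticomm u v (ω ∘ (true ∷_)) S =
  ring x y (wedge v (ω ∘ (false ∷_)) S) (wedge u (ω ∘ (false ∷_)) S) (wedge v (wedge u (ω ∘ (true ∷_))) S)
  where
  ring : ∀ x y p q r → x * p - (y * q - - r) ≡ - (y * q - (x * p - r))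
  ring = solve-∀

wedge-self : (v : Vec ℤ n) (ω : Form n) → ∀ S → wedge v (wedge v ω) S ≡ 0ℤ
wedge-self [] ω S = refl
wedge-self (x ∷ v) ω (false ∷ S) = wedge-self v _ S
wedge-self (x ∷ v) ω (true ∷ S)
  rewrite wedge-sub v x (ω ∘ (false ∷_)) (wedge v (ω ∘ (true ∷_))) S
        | wedge-self v (ω ∘ (true ∷_)) S = ring (x * wedge v (ω ∘ (false ∷_)) S)
  where
  ring : ∀ p → p - (p - 0ℤ) ≡ 0ℤ
  ring = solve-∀

-- The Clifford relation between multiplication and contraction. It drives both the norm inequality
-- and the independence arguments.
contract-wedge : (w v : Vec ℤ n) (ω : Form n) →
  ∀ S → contract w (wedge v ω) S ≡ dot w v * ω S - wedge v (contract w ω) S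
contract-wedge [] [] ω S = refl
contract-wedge (y ∷ w) (x ∷ v) ω (false ∷ S)
  rewrite contract-wedge w v (ω ∘ (false ∷_)) S = begin
  dot w v * p - r + y * (x * p - q)     ≡⟨ ring x y p q r (dot w v) ⟩
  (y * x + dot w v) * p - (r + y * q)   ≡⟨ cong (λ z → (y * x + dot w v) * p - z) contract-false ⟨
  (y * x + dot w v) * p - wedge v (contract (y ∷ w) ω ∘ (false ∷_)) S ∎
  where
  p q r : ℤ
  p = ω (false ∷ S)
  q = wedge v (ω ∘ (true ∷_)) S
  r = wedge v (contract w (ω ∘ (false ∷_))) S
  ring : ∀ x y p q r d → d * p - r + y * (x * p - q) ≡ (y * x + d) * p - (r + y * q)
  ring = solve-∀
  one* : ∀ a → 1ℤ * a ≡ a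
  one* = ℤₚ.*-identityˡ
  contract-false : wedge v (contract (y ∷ w) ω ∘ (false ∷_)) S ≡ r + y * q
  contract-false = begin
    wedge v (λ T → contract w (ω ∘ (false ∷_)) T + y * ω (true ∷ T)) S
      ≡⟨ wedge-cong v (λ T → cong (_+ y * ω (true ∷ T)) (sym (one* (contract w (ω ∘ (false ∷_)) T)))) S ⟩
    wedge v (λ T → 1ℤ * contract w (ω ∘ (false ∷_)) T + y * ω (true ∷ T)) S
      ≡⟨ wedge-linear v 1ℤ y _ _ S ⟩
    1ℤ * r + y * q ≡⟨ cong (_+ y * q) (one* r) ⟩
    r + y * q ∎
contract-wedge (y ∷ w) (x ∷ v) ω (true ∷ S)
  rewrite contract-sub w x (ω ∘ (false ∷_)) (wedge v (ω ∘ (true ∷_))) S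
        | contract-wedge w v (ω ∘ (true ∷_)) S = begin
  - (x * p - (dot w v * q - r))                          ≡⟨ ring x y p q r (dot w v) ⟩
  (y * x + dot w v) * q - (x * (p + y * q) - -1ℤ * r)     ≡⟨ cong (λ z → (y * x + dot w v) * q - (x * (p + y * q) - z)) contract-true ⟨
  (y * x + dot w v) * q - (x * (p + y * q) - wedge v (contract (y ∷ w) ω ∘ (true ∷_)) S) ∎
  where
  p q r : ℤ
  p = contract w (ω ∘ (false ∷_)) S
  q = ω (true ∷ S)
  r = wedge v (contract w (ω ∘ (true ∷_))) S
  ring : ∀ x y p q r d → - (x * p - (d * q - r)) ≡ (y * x + d) * q - (x * (p + y * q) - -1ℤ * r)
  ring = solve-∀
  contract-true : wedge v (contract (y ∷ w) ω ∘ (true ∷_)) S ≡ -1ℤ * r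
  contract-true = trans (wedge-cong v (λ T → sym (ℤₚ.-1*i≡-i (contract w (ω ∘ (true ∷_)) T))) S) (wedge-scale v -1ℤ _ S)

-- The inner product of forms and Hadamard's inequality.

inner : Form n → Form n → ℤ
inner {zero} ω η = ω [] * η []
inner {suc n} ω η = inner (ω ∘ (false ∷_)) (η ∘ (false ∷_)) + inner (ω ∘ (true ∷_)) (η ∘ (true ∷_))

inner-cong : {ω ω′ η η′ : Form n} → ω ≗ ω′ → η ≗ η′ → inner ω η ≡ inner ω′ η′
inner-cong {zero} e e′ = cong₂ _*_ (e []) (e′ [])
inner-cong {suc n} e e′ =
  cong₂ _+_ (inner-cong (e ∘ (false ∷_)) (e′ ∘ (false ∷_))) (inner-cong (e ∘ (true ∷_)) (e′ ∘ (true ∷_)))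

inner-comm : (ω η : Form n) → inner ω η ≡ inner η ω
inner-comm {zero} ω η = ℤₚ.*-comm (ω []) (η [])
inner-comm {suc n} ω η = cong₂ _+_ (inner-comm {n} _ _) (inner-comm {n} _ _)

inner-linear : (a b : ℤ) (ω η ζ : Form n) →
  inner ω (λ S → a * η S + b * ζ S) ≡ a * inner ω η + b * inner ω ζ
inner-linear {zero} a b ω η ζ = ring a b (ω []) (η []) (ζ [])
  where
  ring : ∀ a b x y z → x * (a * y + b * z) ≡ a * (x * y) + b * (x * z)
  ring = solve-∀
inner-linear {suc n} a b ω η ζ
  rewrite inner-linear a b (ω ∘ (false ∷_)) (η ∘ (false ∷_)) (ζ ∘ (false ∷_))
        | inner-linear a b (ω ∘ (true ∷_)) (η ∘ (true ∷_)) (ζ ∘ (true ∷_)) =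
  ring a b (inner (ω ∘ (false ∷_)) (η ∘ (false ∷_))) (inner (ω ∘ (false ∷_)) (ζ ∘ (false ∷_)))
           (inner (ω ∘ (true ∷_)) (η ∘ (true ∷_))) (inner (ω ∘ (true ∷_)) (ζ ∘ (true ∷_)))
  where
  ring : ∀ a b p q r s → a * p + b * q + (a * r + b * s) ≡ a * (p + r) + b * (q + s)
  ring = solve-∀

inner-square : (ω : Form n) → 0ℤ ≤ inner ω ω
inner-square {zero} ω = square-nonneg (ω [])
inner-square {suc n} ω = ℤₚ.+-mono-≤ (inner-square (ω ∘ (false ∷_))) (inner-square (ω ∘ (true ∷_)))

coefficient-bound : (ω : Form n) → ∀ S → ω S * ω S ≤ inner ω ω
coefficient-bound ω [] = ℤₚ.≤-refl
coefficient-bound ω (false ∷ S) =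
  subst (_≤ inner ω ω) (ℤₚ.+-identityʳ _)
    (ℤₚ.+-mono-≤ (coefficient-bound (ω ∘ (false ∷_)) S) (inner-square (ω ∘ (true ∷_))))
coefficient-bound ω (true ∷ S) =
  subst (_≤ inner ω ω) (ℤₚ.+-identityˡ _)
    (ℤₚ.+-mono-≤ (inner-square (ω ∘ (false ∷_))) (coefficient-bound (ω ∘ (true ∷_)) S))

inner-one : inner (one {n}) one ≡ 1ℤ
inner-one {zero} = refl
inner-one {suc n} = cong₂ _+_ (inner-one {n}) (inner-zero n)
  where
  inner-zero : ∀ m → inner {m} (λ _ → 0ℤ) (λ _ → 0ℤ) ≡ 0ℤ
  inner-zero zero = refl
  inner-zero (suc m) = cong₂ _+_ (inner-zero m) (inner-zero m)

-- Together with `contract-wedge`, this turns the squared norm of `wedge v ω` into an expression in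
-- `dot v v` and the squared norms of `ω` and `contract v ω`.
wedge-adjoint : (v : Vec ℤ n) (ω η : Form n) → inner (wedge v ω) η ≡ inner ω (contract v η)
wedge-adjoint [] ω η = sym (ℤₚ.*-zeroʳ (ω []))
wedge-adjoint (x ∷ v) ω η = begin
  inner (wedge v ωf) ηf + inner (λ S → x * ωf S - wedge v ωt S) ηt
    ≡⟨ cong₂ _+_ (wedge-adjoint v ωf ηf) left ⟩
  inner ωf (contract v ηf) + (x * inner ωf ηt + -1ℤ * inner ωt (contract v ηt))
    ≡⟨ ring (inner ωf (contract v ηf)) (x * inner ωf ηt) (inner ωt (contract v ηt)) ⟩
  (1ℤ * inner ωf (contract v ηf) + x * inner ωf ηt) + (-1ℤ * inner ωt (contract v ηt) + 0ℤ * inner ωt ηt)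
    ≡⟨ cong₂ _+_ right₁ right₂ ⟨
  inner ωf (λ S → contract v ηf S + x * ηt S) + inner ωt (λ S → - contract v ηt S) ∎
  where
  ωf ωt ηf ηt : Form _
  ωf = ω ∘ (false ∷_)
  ωt = ω ∘ (true ∷_)
  ηf = η ∘ (false ∷_)
  ηt = η ∘ (true ∷_)
  sub : ∀ a b → x * a - b ≡ x * a + -1ℤ * b
  sub a b = cong (λ z → x * a + z) (sym (ℤₚ.-1*i≡-i b))
  ring : ∀ a b c → a + (b + -1ℤ * c) ≡ (1ℤ * a + b) + (-1ℤ * c + 0ℤ)
  ring = solve-∀
  left : inner (λ S → x * ωf S - wedge v ωt S) ηt ≡ x * inner ωf ηt + -1ℤ * inner ωt (contract v ηt)
  left = begin
    inner (λ S → x * ωf S - wedge v ωt S) ηt            ≡⟨ inner-comm _ ηt ⟩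
    inner ηt (λ S → x * ωf S - wedge v ωt S)            ≡⟨ inner-cong {ω = ηt} (λ _ → refl) (λ S → sub (ωf S) _) ⟩
    inner ηt (λ S → x * ωf S + -1ℤ * wedge v ωt S)      ≡⟨ inner-linear x -1ℤ ηt ωf _ ⟩
    x * inner ηt ωf + -1ℤ * inner ηt (wedge v ωt)
      ≡⟨ cong₂ (λ a b → x * a + -1ℤ * b) (inner-comm ηt ωf) (trans (inner-comm ηt _) (wedge-adjoint v ωt ηt)) ⟩
    x * inner ωf ηt + -1ℤ * inner ωt (contract v ηt) ∎
  right₁ : inner ωf (λ S → contract v ηf S + x * ηt S) ≡ 1ℤ * inner ωf (contract v ηf) + x * inner ωf ηt
  right₁ = trans
    (inner-cong {ω = ωf} (λ _ → refl) (λ S → cong (_+ x * ηt S) (sym (ℤₚ.*-identityˡ (contract v ηf S)))))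
    (inner-linear 1ℤ x ωf _ ηt)
  right₂ : inner ωt (λ S → - contract v ηt S) ≡ -1ℤ * inner ωt (contract v ηt) + 0ℤ * inner ωt ηt
  right₂ = trans
    (inner-cong {ω = ωt} (λ _ → refl)
      (λ S → trans (sym (ℤₚ.-1*i≡-i _)) (sym (ℤₚ.+-identityʳ _))))
    (inner-linear -1ℤ 0ℤ ωt _ ηt)

-- The defect in the inequality is the squared norm of contract v ω.
wedge-norm : (v : Vec ℤ n) (ω : Form n) → inner (wedge v ω) (wedge v ω) ≤ dot v v * inner ω ω
wedge-norm v ω = ℤₚ.0≤i-j⇒j≤i (subst (0ℤ ≤_) (sym defect) (inner-square (contract v ω)))
  where
  c : Form _
  c = contract v ω
  sub : ∀ d a b → d * a - b ≡ d * a + -1ℤ * b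
  sub = solve-∀
  ring : ∀ d b → d - (d + -1ℤ * b) ≡ b
  ring = solve-∀
  norm : inner (wedge v ω) (wedge v ω) ≡ dot v v * inner ω ω + -1ℤ * inner c c
  norm = begin
    inner (wedge v ω) (wedge v ω)                      ≡⟨ wedge-adjoint v ω _ ⟩
    inner ω (contract v (wedge v ω))
      ≡⟨ inner-cong {ω = ω} (λ _ → refl) (λ S → trans (contract-wedge v v ω S) (sub (dot v v) (ω S) _)) ⟩
    inner ω (λ S → dot v v * ω S + -1ℤ * wedge v c S)  ≡⟨ inner-linear (dot v v) -1ℤ ω ω _ ⟩
    dot v v * inner ω ω + -1ℤ * inner ω (wedge v c)
      ≡⟨ cong (λ z → dot v v * inner ω ω + -1ℤ * z) (trans (inner-comm ω _) (wedge-adjoint v c ω)) ⟩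
    dot v v * inner ω ω + -1ℤ * inner c c ∎
  defect : dot v v * inner ω ω - inner (wedge v ω) (wedge v ω) ≡ inner c c
  defect = trans (cong (λ z → dot v v * inner ω ω - z) norm) (ring (dot v v * inner ω ω) (inner c c))

wedges : List (Vec ℤ n) → Form n → Form n
wedges [] ω = ω
wedges (v ∷ vs) ω = wedge v (wedges vs ω)

-- The left side is the Gram determinant of `vs`. Each factor multiplies the squared norm by at most
-- `b`, starting from the unit `one`, whose norm is 1.
hadamard : (b : ℕ) (vs : List (Vec ℤ n)) → All (λ v → dot v v ≤ + b) vs →
  inner (wedges vs one) (wedges vs one) ≤ + (b ℕ.^ List.length vs)
hadamard {n} b [] [] = ℤₚ.≤-reflexive (inner-one {n})
hadamard {n} b (v ∷ vs) (v≤b ∷ vs≤b) = ℤ≤.begin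
  inner (wedges (v ∷ vs) one) (wedges (v ∷ vs) one) ℤ≤.≤⟨ wedge-norm v (wedges vs one) ⟩
  dot v v * N                                       ℤ≤.≤⟨ ℤₚ.*-monoʳ-≤-nonNeg N {{nonNegative (inner-square (wedges vs one))}} v≤b ⟩
  + b * N                                           ℤ≤.≤⟨ ℤₚ.*-monoˡ-≤-nonNeg (+ b) (hadamard b vs vs≤b) ⟩
  + b * + (b ℕ.^ List.length vs)                    ℤ≤.≡⟨ ℤₚ.pos-* b _ ⟨
  + (b ℕ.^ List.length (v ∷ vs))                    ℤ≤.∎
  where
  module ℤ≤ = ℤₚ.≤-Reasoning
  N : ℤ
  N = inner (wedges vs one) (wedges vs one)

-- Degree, repeated factors and nonvanishing products.

VanishesBelow : ℕ → Form n → Set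
VanishesBelow k ω = ∀ S → ∣ S ∣ₛ ℕ.< k → ω S ≡ 0ℤ

wedge-degree : ∀ k (v : Vec ℤ n) (ω : Form n) → VanishesBelow k ω → VanishesBelow (suc k) (wedge v ω)
wedge-degree k [] ω h S lt = refl
wedge-degree k (x ∷ v) ω h (false ∷ S) lt = wedge-degree k v _ (h ∘ (false ∷_)) S lt
wedge-degree (suc k) (x ∷ v) ω h (true ∷ S) (s≤s lt)
  rewrite h (false ∷ S) lt | wedge-degree k v (ω ∘ (true ∷_)) (λ T → h (true ∷ T) ∘ s≤s) S lt
        | ℤₚ.*-zeroʳ x = refl
wedge-degree zero (x ∷ v) ω h (true ∷ S) (s≤s ())

wedges-degree : (vs : List (Vec ℤ n)) (ω : Form n) → VanishesBelow (List.length vs) (wedges vs ω)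
wedges-degree [] ω S ()
wedges-degree (v ∷ vs) ω = wedge-degree _ v _ (wedges-degree vs ω)

-- A nonzero coordinate sits at a set with at least as many elements as there are factors, and no
-- subset has more than `n` elements.
nonzero-length : (vs : List (Vec ℤ n)) (ω : Form n) (S : Subset n) →
  wedges vs ω S ≢ 0ℤ → List.length vs ℕ.≤ n
nonzero-length vs ω S ≢0 with List.length vs ℕ.≤? ∣ S ∣ₛ
... | yes le = ℕₚ.≤-trans le (∣p∣≤n S)
... | no nle = ⊥-elim (≢0 (wedges-degree vs ω S (ℕₚ.≰⇒> nle)))

wedge-∈ : {v : Vec ℤ n} {vs : List (Vec ℤ n)} → v ∈ vs → (ω : Form n) → ∀ S → wedge v (wedges vs ω) S ≡ 0ℤ
wedge-∈ {v = v} {vs = _ ∷ vs} (here refl) ω S = wedge-self v (wedges vs ω) S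
wedge-∈ {v = v} {vs = u ∷ vs} (there v∈vs) ω S =
  trans (wedge-anticomm v u _ S) (cong -_ (wedge-0 u (wedge-∈ v∈vs ω) S))

-- Here `ε` is the sign of the permutation that brings `v` to the front.
wedges-front : (us : List (Vec ℤ n)) (v : Vec ℤ n) (vs : List (Vec ℤ n)) (ω : Form n) →
  ∃[ ε ] ∣ ε ∣ ≡ 1 × (∀ S → wedges (us ++ v ∷ vs) ω S ≡ ε * wedge v (wedges (us ++ vs) ω) S)
wedges-front [] v vs ω = 1ℤ , refl , λ S → sym (ℤₚ.*-identityˡ _)
wedges-front (u ∷ us) v vs ω with wedges-front us v vs ω
... | ε , ∣ε∣≡1 , eq = - ε , trans (ℤₚ.∣-i∣≡∣i∣ ε) ∣ε∣≡1 , λ S → begin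
  wedge u (wedges (us ++ v ∷ vs) ω) S                    ≡⟨ wedge-cong u eq S ⟩
  wedge u (λ T → ε * wedge v (wedges (us ++ vs) ω) T) S  ≡⟨ wedge-scale u ε _ S ⟩
  ε * wedge u (wedge v (wedges (us ++ vs) ω)) S          ≡⟨ cong (ε *_) (wedge-anticomm u v _ S) ⟩
  ε * - wedge v (wedge u (wedges (us ++ vs) ω)) S        ≡⟨ ring ε _ ⟩
  - ε * wedge v (wedge u (wedges (us ++ vs) ω)) S        ∎
  where
  ring : ∀ a b → a * - b ≡ - a * b
  ring = solve-∀

contract-one : (w : Vec ℤ n) → ∀ S → contract w one S ≡ 0ℤ
contract-one [] S = refl
contract-one (x ∷ w) (false ∷ S) rewrite contract-one w S | ℤₚ.*-zeroʳ x = refl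
contract-one (x ∷ w) (true ∷ S) = cong -_ (contract-0 w (λ _ → refl) S)

-- By the Clifford relation the contraction passes every factor orthogonal to `w`, up to sign, until
-- it reaches `one`, which it kills.
contract-⊥ : (w : Vec ℤ n) (vs : List (Vec ℤ n)) → All (λ v → dot w v ≡ 0ℤ) vs →
  ∀ S → contract w (wedges vs one) S ≡ 0ℤ
contract-⊥ w [] [] = contract-one w
contract-⊥ w (v ∷ vs) (e ∷ es) S
  rewrite contract-wedge w v (wedges vs one) S | e | wedge-0 v (contract-⊥ w vs es) S = refl

-- Makes nonvanishing of a form decidable, so that independence can be proved by contradiction and
-- still yield a coordinate.
search : (ω : Form n) → (∃[ S ] ω S ≢ 0ℤ) ⊎ (∀ S → ω S ≡ 0ℤ)
search {zero} ω with ω [] ℤₚ.≟ 0ℤ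
... | yes e = inj₂ λ { [] → e }
... | no ne = inj₁ ([] , ne)
search {suc n} ω with search (ω ∘ (false ∷_)) | search (ω ∘ (true ∷_))
... | inj₁ (S , ne) | _ = inj₁ (false ∷ S , ne)
... | inj₂ _ | inj₁ (S , ne) = inj₁ (true ∷ S , ne)
... | inj₂ f | inj₂ t = inj₂ λ { (false ∷ S) → f S ; (true ∷ S) → t S }

-- Contracting `v ∧ vs` with `w` leaves `dot w v` times the product of `vs`, because `w` annihilates
-- that product. Hence `v ∧ vs` cannot vanish.
wedge-transversal : (w v : Vec ℤ n) (vs : List (Vec ℤ n)) → dot w v ≢ 0ℤ → All (λ u → dot w u ≡ 0ℤ) vs →
  (∃[ S ] wedges vs one S ≢ 0ℤ) → ∃[ S ] wedges (v ∷ vs) one S ≢ 0ℤ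
wedge-transversal w v vs wv≢0 w⊥vs (S , ne) with search (wedges (v ∷ vs) one)
... | inj₁ found = found
... | inj₂ zero-form = ⊥-elim (product≢0 (begin
  dot w v * wedges vs one S                                          ≡⟨ ring _ ⟩
  dot w v * wedges vs one S - 0ℤ
    ≡⟨ cong (λ z → dot w v * wedges vs one S - z) (wedge-0 v (contract-⊥ w vs w⊥vs) S) ⟨
  dot w v * wedges vs one S - wedge v (contract w (wedges vs one)) S ≡⟨ contract-wedge w v _ S ⟨
  contract w (wedges (v ∷ vs) one) S                                 ≡⟨ contract-0 w zero-form S ⟩
  0ℤ ∎))
  where
  ring : ∀ a → a ≡ a - 0ℤ
  ring = solve-∀
  product≢0 : dot w v * wedges vs one S ≢ 0ℤ
  product≢0 e with ℤₚ.i*j≡0⇒i≡0∨j≡0 (dot w v) e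
  ... | inj₁ z = wv≢0 z
  ... | inj₂ z = ne z

-- Farkas' lemma

-- Linear independence, expressed by a nonzero maximal minor. The coordinate `S` is kept because
-- that minor becomes the denominator in Cramer's rule.
Independent : List (Vec ℤ n) → Set
Independent vs = ∃[ S ] wedges vs one S ≢ 0ℤ

combination : (A → Vec ℤ n) → List (ℤ × A) → Vec ℤ n
combination f [] = replicate _ 0ℤ
combination f ((c , a) ∷ L) = c ⊡ f a ⊞ combination f L

support : (A → Vec ℤ n) → List (ℤ × A) → List (Vec ℤ n)
support f = List.map (f ∘ proj₂)

Separated : (A → Vec ℤ n) → List A → Vec ℤ n → Set
Separated f as t = ∃[ w ] All (λ a → 0ℤ ≤ dot w (f a)) as × dot w t < 0ℤ

-- A basic solution with denominators cleared: `scale` is a common denominator of the rational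
-- coefficients of `t`.
record Basic {A : Set} {n : ℕ} (f : A → Vec ℤ n) (as : List A) (t : Vec ℤ n) : Set where
  constructor basic
  field
    terms       : List (ℤ × A)
    scale       : ℤ
    scale>0     : 0ℤ < scale
    terms⊆      : All (λ x → proj₂ x ∈ as) terms
    terms≥0     : All (λ x → 0ℤ ≤ proj₁ x) terms
    represents  : scale ⊡ t ≡ combination f terms
    independent : Independent (support f terms)

dot-zeroʳ : (w : Vec ℤ n) → dot w (replicate n 0ℤ) ≡ 0ℤ
dot-zeroʳ [] = refl
dot-zeroʳ (x ∷ w) rewrite dot-zeroʳ w | ℤₚ.*-zeroʳ x = refl

dot-self : (t : Vec ℤ n) → t ≡ replicate n 0ℤ ⊎ 0ℤ < dot t t
dot-self [] = inj₁ refl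
dot-self (x ∷ t) with x ℤₚ.≟ 0ℤ | dot-self t
... | yes refl | inj₁ refl = inj₁ refl
... | yes refl | inj₂ pos = inj₂ (subst (0ℤ <_) (sym (ℤₚ.+-identityˡ _)) pos)
... | no x≢0 | t-case = inj₂ (ℤₚ.+-mono-<-≤ (square-pos x x≢0) (nonneg t-case))
  where
  square-pos : ∀ i → i ≢ 0ℤ → 0ℤ < i * i
  square-pos (+ zero) ≢0 = ⊥-elim (≢0 refl)
  square-pos (+ suc m) _ = +<+ (s≤s z≤n)
  square-pos -[1+ m ] _ = +<+ (s≤s z≤n)
  nonneg : t ≡ replicate _ 0ℤ ⊎ 0ℤ < dot t t → 0ℤ ≤ dot t t
  nonneg (inj₁ e) = ℤₚ.≤-reflexive (sym (trans (cong (dot t) e) (dot-zeroʳ t)))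
  nonneg (inj₂ pos) = ℤₚ.<⇒≤ pos

combination-rescale : (f : A → Vec ℤ n) (s : ℤ) (L : List (ℤ × A)) →
  combination f (List.map (map₁ (s *_)) L) ≡ s ⊡ combination f L
combination-rescale f s [] = zeros _
  where
  zeros : ∀ m → replicate m 0ℤ ≡ s ⊡ replicate m 0ℤ
  zeros zero = refl
  zeros (suc m) = cong₂ _∷_ (sym (ℤₚ.*-zeroʳ s)) (zeros m)
combination-rescale f s ((c , a) ∷ L) = trans (cong ((s * c) ⊡ f a ⊞_) (combination-rescale f s L)) (distrib (f a) _)
  where
  distrib : ∀ {m} (u v : Vec ℤ m) → (s * c) ⊡ u ⊞ s ⊡ v ≡ s ⊡ (c ⊡ u ⊞ v)
  distrib [] [] = refl
  distrib (x ∷ u) (y ∷ v) = cong₂ _∷_ (ring s c x y) (distrib u v)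
    where
    ring : ∀ s c x y → s * c * x + s * y ≡ s * (c * x + y)
    ring = solve-∀

-- slide w v s x is s times the projection of x along v into the hyperplane w^⊥ when s = - dot w v.
slide : Vec ℤ n → Vec ℤ n → ℤ → Vec ℤ n → Vec ℤ n
slide w v s x = s ⊡ x ⊞ dot w x ⊡ v

module _ (w v : Vec ℤ n) where
  -- The transpose of `slide`. It carries a functional found for the projected problem back to the
  -- original one.
  dot-slide : ∀ s w′ x → dot w′ (slide w v s x) ≡ dot (s ⊡ w′ ⊞ dot w′ v ⊡ w) x
  dot-slide s w′ x = begin
    dot w′ (s ⊡ x ⊞ dot w x ⊡ v)                     ≡⟨ dot-⊞ w′ _ _ ⟩
    dot w′ (s ⊡ x) + dot w′ (dot w x ⊡ v)            ≡⟨ cong₂ _+_ (dot-⊡ w′ s x) (dot-⊡ w′ (dot w x) v) ⟩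
    s * dot w′ x + dot w x * dot w′ v
      ≡⟨ cong₂ (λ a b → s * a + b) (dot-comm w′ x) (trans (ℤₚ.*-comm (dot w x) _) (cong (dot w′ v *_) (dot-comm w x))) ⟩
    s * dot x w′ + dot w′ v * dot x w                ≡⟨ cong₂ _+_ (dot-⊡ x s w′) (dot-⊡ x (dot w′ v) w) ⟨
    dot x (s ⊡ w′) + dot x (dot w′ v ⊡ w)            ≡⟨ dot-⊞ x _ _ ⟨
    dot x (s ⊡ w′ ⊞ dot w′ v ⊡ w)                    ≡⟨ dot-comm x _ ⟩
    dot (s ⊡ w′ ⊞ dot w′ v ⊡ w) x                    ∎

  slide-⊥ : ∀ x → dot w (slide w v (- dot w v) x) ≡ 0ℤ
  slide-⊥ x = begin
    dot w (slide w v (- dot w v) x)                                 ≡⟨ dot-⊞ w _ _ ⟩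
    dot w (- dot w v ⊡ x) + dot w (dot w x ⊡ v)                     ≡⟨ cong₂ _+_ (dot-⊡ w (- dot w v) x) (dot-⊡ w (dot w x) v) ⟩
    - dot w v * dot w x + dot w x * dot w v                         ≡⟨ ring (dot w v) (dot w x) ⟩
    0ℤ ∎
    where
    ring : ∀ a b → - a * b + b * a ≡ 0ℤ
    ring = solve-∀

  -- Modulo `v`, sliding is multiplication by `s`, and multiples of `v` disappear after wedging with
  -- `v`. So `κ` is `s` to the number of vectors.
  wedge-slides : ∀ s (vs : List (Vec ℤ n)) (ω : Form n) →
    ∃[ κ ] ∀ S → wedges (v ∷ List.map (slide w v s) vs) ω S ≡ κ * wedges (v ∷ vs) ω S
  wedge-slides s [] ω = 1ℤ , λ S → sym (ℤₚ.*-identityˡ _)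
  wedge-slides s (u ∷ us) ω with wedge-slides s us ω
  ... | κ , eq = s * κ , λ S → begin
    wedge v (wedge (s ⊡ u ⊞ dot w u ⊡ v) Ω′) S                    ≡⟨ wedge-anticomm v (s ⊡ u ⊞ dot w u ⊡ v) Ω′ S ⟩
    - wedge (s ⊡ u ⊞ dot w u ⊡ v) (wedge v Ω′) S
      ≡⟨ cong -_ (trans (wedge-⊞ (s ⊡ u) (dot w u ⊡ v) (wedge v Ω′) S) (cong₂ _+_ (wedge-⊡ s u (wedge v Ω′) S) (wedge-⊡ (dot w u) v (wedge v Ω′) S))) ⟩
    - (s * wedge u (wedge v Ω′) S + dot w u * wedge v (wedge v Ω′) S)
      ≡⟨ cong₂ (λ a b → - (s * a + dot w u * b)) (trans (wedge-cong u eq S) (wedge-scale u κ _ S)) (wedge-self v Ω′ S) ⟩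
    - (s * (κ * wedge u (wedge v Ω) S) + dot w u * 0ℤ)
      ≡⟨ cong (λ a → - (s * (κ * a) + dot w u * 0ℤ)) (wedge-anticomm u v Ω S) ⟩
    - (s * (κ * - wedge v (wedge u Ω) S) + dot w u * 0ℤ)          ≡⟨ ring s κ (dot w u) _ ⟩
    s * κ * wedge v (wedge u Ω) S ∎
    where
    Ω Ω′ : Form n
    Ω = wedges us ω
    Ω′ = wedges (List.map (slide w v s) us) ω
    ring : ∀ s κ d a → - (s * (κ * - a) + d * 0ℤ) ≡ s * κ * a
    ring = solve-∀

  -- The slid vectors lie in the hyperplane orthogonal to `w` and `v` does not, so adjoining `v`
  -- keeps them independent. Once `v` is a factor, the slides can be undone up to the scalar `κ`.
  independent-unslide : (vs : List (Vec ℤ n)) → dot w v ≢ 0ℤ →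
    Independent (List.map (slide w v (- dot w v)) vs) → Independent (v ∷ vs)
  independent-unslide vs wv≢0 ind
    with wedge-transversal w v (List.map (slide w v (- dot w v)) vs) wv≢0 (Allₚ.map⁺ (All.universal slide-⊥ vs)) ind
       | wedge-slides (- dot w v) vs one
  ... | S , ne | κ , eq = S , λ z → ne (trans (eq S) (trans (cong (κ *_) z) (ℤₚ.*-zeroʳ κ)))

  combination-slide : (f : A → Vec ℤ n) (s : ℤ) (L : List (ℤ × A)) →
    combination (slide w v s ∘ f) L ≡ s ⊡ combination f L ⊞ dot w (combination f L) ⊡ v
  combination-slide f s [] = sym (zeros w v)
    where
    zeros : ∀ {m} (w v : Vec ℤ m) → s ⊡ replicate m 0ℤ ⊞ dot w (replicate m 0ℤ) ⊡ v ≡ replicate m 0ℤ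
    zeros w v rewrite dot-zeroʳ w = go v
      where
      ring : ∀ s x → s * 0ℤ + 0ℤ * x ≡ 0ℤ
      ring = solve-∀
      go : ∀ {m} (v : Vec ℤ m) → s ⊡ replicate m 0ℤ ⊞ 0ℤ ⊡ v ≡ replicate m 0ℤ
      go [] = refl
      go (x ∷ v) = cong₂ _∷_ (ring s x) (go v)
  combination-slide f s ((c , a) ∷ L)
    rewrite combination-slide f s L | dot-⊞ w (c ⊡ f a) (combination f L) | dot-⊡ w c (f a) =
    distrib (dot w (f a)) (dot w (combination f L)) (f a) (combination f L) v
    where
    ring : ∀ c s p q x y z → c * (s * x + p * z) + (s * y + q * z) ≡ s * (c * x + y) + (c * p + q) * z
    ring = solve-∀
    distrib : ∀ {m} p q (x y z : Vec ℤ m) →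
      c ⊡ (s ⊡ x ⊞ p ⊡ z) ⊞ (s ⊡ y ⊞ q ⊡ z) ≡ s ⊡ (c ⊡ x ⊞ y) ⊞ (c * p + q) ⊡ z
    distrib p q [] [] [] = refl
    distrib p q (x ∷ xs) (y ∷ ys) (z ∷ zs) = cong₂ _∷_ (ring c s p q x y z) (distrib p q xs ys zs)


*-nonneg : ∀ {i j} → 0ℤ ≤ i → 0ℤ ≤ j → 0ℤ ≤ i * j
*-nonneg {i} {j} i≥0 j≥0 = subst (_≤ i * j) (ℤₚ.*-zeroʳ i) (ℤₚ.*-monoˡ-≤-nonNeg i {{nonNegative i≥0}} j≥0)

*-pos : ∀ {i j} → 0ℤ < i → 0ℤ < j → 0ℤ < i * j
*-pos {i} {j} i>0 j>0 = subst (_< i * j) (ℤₚ.*-zeroʳ i) (ℤₚ.*-monoˡ-<-pos i {{positive i>0}} j>0)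

combination-dot≥0 : (w : Vec ℤ n) (f : A → Vec ℤ n) {as : List A} → All (λ a → 0ℤ ≤ dot w (f a)) as →
  (L : List (ℤ × A)) → All (λ x → proj₂ x ∈ as) L → All (λ x → 0ℤ ≤ proj₁ x) L → 0ℤ ≤ dot w (combination f L)
combination-dot≥0 w f h [] [] [] = ℤₚ.≤-reflexive (sym (dot-zeroʳ w))
combination-dot≥0 w f h ((c , a) ∷ L) (a∈ ∷ L⊆) (c≥0 ∷ L≥0) =
  subst (0ℤ ≤_) (sym (trans (dot-⊞ w _ _) (cong (_+ _) (dot-⊡ w c (f a)))))
    (ℤₚ.+-mono-≤ (*-nonneg c≥0 (All.lookup h a∈)) (combination-dot≥0 w f h L L⊆ L≥0))

-- If w separates t from as but not from a, then projecting along f a into w^⊥ reduces to as, and f a is independent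
-- of any independent family lifted back from w^⊥ .
farkas : (f : A → Vec ℤ n) (as : List A) (t : Vec ℤ n) → Separated f as t ⊎ Basic f as t
farkas {n = n} f [] t with dot-self t
... | inj₁ refl = inj₂ (basic [] 1ℤ (+<+ (s≤s z≤n)) [] [] (unit-scale t) (replicate n false , one≢0 n))
  where
  unit-scale : ∀ {m} (v : Vec ℤ m) → 1ℤ ⊡ v ≡ v
  unit-scale [] = refl
  unit-scale (x ∷ v) = cong₂ _∷_ (ℤₚ.*-identityˡ x) (unit-scale v)
  one≢0 : ∀ m → one (replicate m false) ≢ 0ℤ
  one≢0 zero ()
  one≢0 (suc m) = one≢0 m
-- With no vectors to respect, `- t` itself separates a nonzero `t`.
... | inj₂ tt>0 = inj₁ (-1ℤ ⊡ t , [] , subst (_< 0ℤ) (sym eq) (ℤₚ.neg-mono-< tt>0))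
  where
  eq : dot (-1ℤ ⊡ t) t ≡ - dot t t
  eq = trans (dot-comm _ t) (trans (dot-⊡ t -1ℤ t) (ℤₚ.-1*i≡-i _))
farkas f (a ∷ as) t with farkas f as t
... | inj₂ (basic L D D>0 L⊆ L≥0 eq ind) = inj₂ (basic L D D>0 (All.map there L⊆) L≥0 eq ind)
... | inj₁ (w , w≥0 , wt<0) with 0ℤ ℤₚ.≤? dot w (f a)
...   | yes wa≥0 = inj₁ (w , wa≥0 ∷ w≥0 , wt<0)
...   | no wa≱0 with farkas (slide w (f a) (- dot w (f a)) ∘ f) as (slide w (f a) (- dot w (f a)) t)
...     | inj₁ (w′ , w′≥0 , w′t<0) = inj₁ (w″ , ℤₚ.≤-reflexive (sym w″a≡0) ∷ All.map (subst (0ℤ ≤_) (turn _)) w′≥0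
                                          , subst (_< 0ℤ) (turn t) w′t<0)
  where
  s : ℤ
  s = - dot w (f a)
  -- The pullback of `w′` along the slide. It vanishes on `f a` because the slide sends `f a` to
  -- zero.
  w″ : Vec ℤ _
  w″ = s ⊡ w′ ⊞ dot w′ (f a) ⊡ w
  turn : ∀ x → dot w′ (slide w (f a) s x) ≡ dot w″ x
  turn = dot-slide w (f a) s w′
  w″a≡0 : dot w″ (f a) ≡ 0ℤ
  w″a≡0 = begin
    dot w″ (f a)                                     ≡⟨ turn (f a) ⟨
    dot w′ (s ⊡ f a ⊞ dot w (f a) ⊡ f a)             ≡⟨ dot-⊞ w′ _ _ ⟩
    dot w′ (s ⊡ f a) + dot w′ (dot w (f a) ⊡ f a)    ≡⟨ cong₂ _+_ (dot-⊡ w′ s (f a)) (dot-⊡ w′ (dot w (f a)) (f a)) ⟩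
    - dot w (f a) * dot w′ (f a) + dot w (f a) * dot w′ (f a) ≡⟨ ring (dot w (f a)) _ ⟩
    0ℤ ∎
    where
    ring : ∀ p q → - p * q + p * q ≡ 0ℤ
    ring = solve-∀
...     | inj₂ (basic L D D>0 L⊆ L≥0 eq ind) =
  -- Unfolding the slides on both sides of `eq` and collecting the multiples of `f a` gives
  -- `(D * s) ⊡ t` as `s ⊡ ℓ` plus `dot w ℓ - D * dot w t` times `f a`. This coefficient is
  -- nonnegative since `dot w t` is negative and `dot w ℓ` is not.
  inj₂ (basic ((dot w ℓ - D * dot w t , a) ∷ List.map (map₁ (s *_)) L) (D * s) (*-pos D>0 s>0)
    (here refl ∷ Allₚ.map⁺ (All.map there L⊆))
    (ℤₚ.i≤j⇒0≤j-i Dwt≤wℓ ∷ Allₚ.map⁺ (All.map (*-nonneg (ℤₚ.<⇒≤ s>0)) L≥0))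
    lifted
    (subst (λ vs → Independent (f a ∷ vs)) same
      (independent-unslide w (f a) (support f L) (λ wa≡0 → wa≱0 (ℤₚ.≤-reflexive (sym wa≡0)))
        (subst Independent (Listₚ.map-∘ L) ind))))
  where
  s : ℤ
  s = - dot w (f a)
  ℓ : Vec ℤ _
  ℓ = combination f L
  s>0 : 0ℤ < s
  s>0 = ℤₚ.neg-mono-< (ℤₚ.≰⇒> wa≱0)
  Dwt≤wℓ : D * dot w t ≤ dot w ℓ
  Dwt≤wℓ = ℤₚ.≤-trans
    (subst (D * dot w t ≤_) (ℤₚ.*-zeroʳ D) (ℤₚ.*-monoˡ-≤-nonNeg D {{nonNegative (ℤₚ.<⇒≤ D>0)}} (ℤₚ.<⇒≤ wt<0)))
    (combination-dot≥0 w f w≥0 L L⊆ L≥0)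
  same : support f L ≡ support f (List.map (map₁ (s *_)) L)
  same = Listₚ.map-∘ L
  rearrange : ∀ {m} (p q : ℤ) (t v y : Vec ℤ m) → D ⊡ (s ⊡ t ⊞ p ⊡ v) ≡ s ⊡ y ⊞ q ⊡ v →
    (D * s) ⊡ t ≡ (q - D * p) ⊡ v ⊞ s ⊡ y
  rearrange p q [] [] [] _ = refl
  rearrange p q (t ∷ ts) (v ∷ vs) (y ∷ ys) e = cong₂ _∷_
    (begin
      D * s * t                                   ≡⟨ ring₁ D s t p v ⟩
      D * (s * t + p * v) - D * p * v             ≡⟨ cong (_- D * p * v) (Vecₚ.∷-injectiveˡ e) ⟩
      s * y + q * v - D * p * v                   ≡⟨ ring₂ D s y p q v ⟩
      (q - D * p) * v + s * y                     ∎)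
    (rearrange p q ts vs ys (Vecₚ.∷-injectiveʳ e))
    where
    ring₁ : ∀ D s t p v → D * s * t ≡ D * (s * t + p * v) - D * p * v
    ring₁ = solve-∀
    ring₂ : ∀ D s y p q v → s * y + q * v - D * p * v ≡ (q - D * p) * v + s * y
    ring₂ = solve-∀
  lifted : (D * s) ⊡ t ≡ (dot w ℓ - D * dot w t) ⊡ f a ⊞ combination f (List.map (map₁ (s *_)) L)
  lifted = trans
    (rearrange (dot w t) (dot w ℓ) t (f a) ℓ (trans eq (combination-slide w (f a) f s L)))
    (cong ((dot w ℓ - D * dot w t) ⊡ f a ⊞_) (sym (combination-rescale f s L)))

-- Cramer's rule

wedge-zeros : (ω : Form n) (S : Subset n) → wedge (replicate n 0ℤ) ω S ≡ 0ℤ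
wedge-zeros ω [] = refl
wedge-zeros ω (false ∷ S) = wedge-zeros _ S
wedge-zeros ω (true ∷ S) rewrite wedge-zeros (ω ∘ (true ∷_)) S = refl

wedge-combination-0 : (f : A → Vec ℤ n) (L : List (ℤ × A)) (ω : Form n) (S : Subset n) →
  All (λ v → wedge v ω S ≡ 0ℤ) (support f L) → wedge (combination f L) ω S ≡ 0ℤ
wedge-combination-0 f [] ω S [] = wedge-zeros ω S
wedge-combination-0 f ((d , b) ∷ L) ω S (e ∷ es)
  rewrite wedge-⊞ (d ⊡ f b) (combination f L) ω S | wedge-⊡ d (f b) ω S | e
        | wedge-combination-0 f L ω S es | ℤₚ.*-zeroʳ d = refl

wedge-combination : (f : A → Vec ℤ n) (L M : List (ℤ × A)) (c : ℤ) (a : A) (ω : Form n) (S : Subset n) →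
  All (λ v → wedge v ω S ≡ 0ℤ) (support f L) → All (λ v → wedge v ω S ≡ 0ℤ) (support f M) →
  wedge (combination f (L ++ (c , a) ∷ M)) ω S ≡ c * wedge (f a) ω S
wedge-combination f ((d , b) ∷ L) M c a ω S (e ∷ es) es′
  rewrite wedge-⊞ (d ⊡ f b) (combination f (L ++ (c , a) ∷ M)) ω S | wedge-⊡ d (f b) ω S | e
        | wedge-combination f L M c a ω S es es′ | ℤₚ.*-zeroʳ d = ℤₚ.+-identityˡ _
wedge-combination {n = n} f [] M c a ω S [] es′
  rewrite wedge-⊞ (c ⊡ f a) (combination f M) ω S | wedge-⊡ c (f a) ω S | wedge-combination-0 f M ω S es′ = ℤₚ.+-identityʳ _

-- Wedging `D ⊡ t` with all the other support vectors kills every term but the one of `(c , a)`.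
-- Comparing coordinates at `S` gives the ratio, with `τ` the absolute value of the minor in which
-- `t` replaces `f a`; `hadamard` bounds that minor.
cramer : (f : A → Vec ℤ n) (b : ℕ) (t : Vec ℤ n) → (∀ a → dot (f a) (f a) ≤ + b) → dot t t ≤ + b →
  (L : List (ℤ × A)) (D : ℤ) → D ⊡ t ≡ combination f L → ∀ S {c a} → (c , a) ∈ L →
  ∃[ τ ] ∣ D ∣ ℕ.* τ ≡ ∣ c ∣ ℕ.* ∣ wedges (support f L) one S ∣ × τ ℕ.* τ ℕ.≤ b ℕ.^ List.length L
cramer f b t f≤b t≤b L D eq S {c} {a} x∈L with ∈-∃++ x∈L
... | pre , post , refl
  with wedges-front (support f pre) (f a) (support f post) one
...   | ε , ∣ε∣≡1 , front = ∣ T ∣ , ratio , ℤₚ.drop‿+≤+ bound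
  where
  others : List (Vec ℤ _)
  others = support f pre ++ support f post
  Ω : Form _
  Ω = wedges others one
  T : ℤ
  T = wedge t Ω S
  DT : D * T ≡ c * wedge (f a) Ω S
  DT = begin
    D * wedge t Ω S                                    ≡⟨ wedge-⊡ D t Ω S ⟨
    wedge (D ⊡ t) Ω S                                  ≡⟨ cong (λ v → wedge v Ω S) eq ⟩
    wedge (combination f (pre ++ (c , a) ∷ post)) Ω S
      ≡⟨ wedge-combination f pre post c a Ω S
           (All.tabulate (λ v∈ → wedge-∈ (∈-++⁺ˡ v∈) one S))
           (All.tabulate (λ v∈ → wedge-∈ (∈-++⁺ʳ (support f pre) v∈) one S)) ⟩
    c * wedge (f a) Ω S ∎
  W-abs : ∣ wedges (support f (pre ++ (c , a) ∷ post)) one S ∣ ≡ ∣ wedge (f a) Ω S ∣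
  W-abs = begin
    ∣ wedges (support f (pre ++ (c , a) ∷ post)) one S ∣
      ≡⟨ cong (λ vs → ∣ wedges vs one S ∣) (Listₚ.map-++ (f ∘ proj₂) pre _) ⟩
    ∣ wedges (support f pre ++ f a ∷ support f post) one S ∣   ≡⟨ cong ∣_∣ (front S) ⟩
    ∣ ε * wedge (f a) Ω S ∣                                    ≡⟨ ℤₚ.abs-* ε _ ⟩
    ∣ ε ∣ ℕ.* ∣ wedge (f a) Ω S ∣                              ≡⟨ cong (ℕ._* ∣ wedge (f a) Ω S ∣) ∣ε∣≡1 ⟩
    1 ℕ.* ∣ wedge (f a) Ω S ∣                                  ≡⟨ ℕₚ.*-identityˡ _ ⟩
    ∣ wedge (f a) Ω S ∣ ∎
  ratio : ∣ D ∣ ℕ.* ∣ T ∣ ≡ ∣ c ∣ ℕ.* ∣ wedges (support f (pre ++ (c , a) ∷ post)) one S ∣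
  ratio = begin
    ∣ D ∣ ℕ.* ∣ T ∣                     ≡⟨ ℤₚ.abs-* D T ⟨
    ∣ D * T ∣                           ≡⟨ cong ∣_∣ DT ⟩
    ∣ c * wedge (f a) Ω S ∣             ≡⟨ ℤₚ.abs-* c _ ⟩
    ∣ c ∣ ℕ.* ∣ wedge (f a) Ω S ∣       ≡⟨ cong (∣ c ∣ ℕ.*_) W-abs ⟨
    ∣ c ∣ ℕ.* ∣ wedges (support f (pre ++ (c , a) ∷ post)) one S ∣ ∎
  length-t∷others : List.length (t ∷ others) ≡ List.length (pre ++ (c , a) ∷ post)
  length-t∷others = begin
    suc (List.length (support f pre ++ support f post))   ≡⟨ cong (suc ∘ List.length) (Listₚ.map-++ (f ∘ proj₂) pre post) ⟨
    suc (List.length (support f (pre ++ post)))           ≡⟨ cong suc (Listₚ.length-map (f ∘ proj₂) (pre ++ post)) ⟩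
    suc (List.length (pre ++ post))                       ≡⟨ cong suc (Listₚ.length-++ pre) ⟩
    suc (List.length pre ℕ.+ List.length post)            ≡⟨ ℕₚ.+-suc _ _ ⟨
    List.length pre ℕ.+ suc (List.length post)            ≡⟨ Listₚ.length-++ pre ⟨
    List.length (pre ++ (c , a) ∷ post) ∎
  abs-square : ∀ i → + (∣ i ∣ ℕ.* ∣ i ∣) ≡ i * i
  abs-square i = trans (cong (+_) (sym (ℤₚ.abs-* i i))) (ℤₚ.0≤i⇒+∣i∣≡i (square-nonneg i))
  bound : + (∣ T ∣ ℕ.* ∣ T ∣) ≤ + (b ℕ.^ List.length (pre ++ (c , a) ∷ post))
  bound = ℤₚ.≤-trans (ℤₚ.≤-reflexive (abs-square T))
    (ℤₚ.≤-trans (coefficient-bound (wedges (t ∷ others) one) S)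
      (subst (λ k → inner (wedges (t ∷ others) one) (wedges (t ∷ others) one) ≤ + (b ℕ.^ k)) length-t∷others
        (hadamard b (t ∷ others) (t≤b ∷ Allₚ.++⁺ (Allₚ.map⁺ (All.universal (f≤b ∘ proj₂) pre))
                                                  (Allₚ.map⁺ (All.universal (f≤b ∘ proj₂) post))))))

⊡-cancel : (s : ℤ) {{_ : NonZero s}} (u v : Vec ℤ n) → s ⊡ u ≡ s ⊡ v → u ≡ v
⊡-cancel s [] [] _ = refl
⊡-cancel s (x ∷ u) (y ∷ v) e =
  cong₂ _∷_ (ℤₚ.*-cancelˡ-≡ s x y (Vecₚ.∷-injectiveˡ e)) (⊡-cancel s u v (Vecₚ.∷-injectiveʳ e))

⊡-comm : (s r : ℤ) (v : Vec ℤ n) → s ⊡ r ⊡ v ≡ r ⊡ s ⊡ v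
⊡-comm s r [] = refl
⊡-comm s r (x ∷ v) = cong₂ _∷_ (ring s r x) (⊡-comm s r v)
  where
  ring : ∀ s r x → s * (r * x) ≡ r * (s * x)
  ring = solve-∀

-- The bound is put on the squares of the coefficients, since the square root of `B` may be
-- irrational.
record Small {A : Set} {n : ℕ} (f : A → Vec ℤ n) (t : Vec ℤ n) (B : ℕ) : Set where
  constructor small
  field
    terms        : List (ℕ × A)
    scale        : ℕ
    scale>0      : 1 ℕ.≤ scale
    terms-length : List.length terms ℕ.≤ n
    terms-bound  : All (λ x → proj₁ x ℕ.* proj₁ x ℕ.≤ B) terms
    represents   : + scale ⊡ t ≡ combination f (List.map (map₁ (+_)) terms)

-- Multiply the representation of `D ⊡ t` by the minor `W`. By Cramer each coefficient `c * W`
-- equals `D * τ`, so `D` cancels and leaves `W ⊡ t` with the bounded coefficients `τ`.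
basic⇒small : (f : A → Vec ℤ n) (b : ℕ) (t : Vec ℤ n) → 1 ℕ.≤ b →
  (∀ a → dot (f a) (f a) ≤ + b) → dot t t ≤ + b → {as : List A} → Basic f as t → Small f t (b ℕ.^ n)
basic⇒small {A} {n} f b t b≥1 f≤b t≤b (basic L D D>0 _ L≥0 eq (S , W≢0)) =
  small (proj₁ rebuilt) W (ℕₚ.n≢0⇒n>0 (W≢0 ∘ ℤₚ.∣i∣≡0⇒i≡0))
    (subst (ℕ._≤ n) (sym (proj₁ (proj₂ rebuilt))) k≤n)
    (All.map (λ le → ℕₚ.≤-trans le (ℕₚ.^-monoʳ-≤ b {{ℕ.>-nonZero b≥1}} k≤n)) (proj₁ (proj₂ (proj₂ rebuilt))))
    (⊡-cancel D {{>-nonZero D>0}} _ _ (begin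
      D ⊡ + W ⊡ t                ≡⟨ ⊡-comm D (+ W) t ⟩
      + W ⊡ D ⊡ t                ≡⟨ cong (+ W ⊡_) eq ⟩
      + W ⊡ combination f L      ≡⟨ proj₂ (proj₂ (proj₂ rebuilt)) ⟨
      D ⊡ combination f (List.map (map₁ (+_)) (proj₁ rebuilt)) ∎))
  where
  W : ℕ
  W = ∣ wedges (support f L) one S ∣
  k≤n : List.length L ℕ.≤ n
  k≤n = subst (ℕ._≤ n) (Listₚ.length-map (f ∘ proj₂) L) (nonzero-length (support f L) one S W≢0)
  B : ℕ
  B = b ℕ.^ List.length L
  -- The recursion runs over tails `M` of the list, while `W` and `B` remain those of the whole of
  -- `L`.
  rebuild : (M : List (ℤ × A)) → All (λ x → 0ℤ ≤ proj₁ x) M →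
    All (λ x → ∃[ τ ] ∣ D ∣ ℕ.* τ ≡ ∣ proj₁ x ∣ ℕ.* W × τ ℕ.* τ ℕ.≤ B) M →
    ∃[ M′ ] List.length M′ ≡ List.length M × All (λ x → proj₁ x ℕ.* proj₁ x ℕ.≤ B) M′ ×
      D ⊡ combination f (List.map (map₁ (+_)) M′) ≡ + W ⊡ combination f M
  rebuild [] [] [] = [] , refl , [] , zeros n
    where
    zeros : ∀ m → D ⊡ replicate m 0ℤ ≡ + W ⊡ replicate m 0ℤ
    zeros zero = refl
    zeros (suc m) = cong₂ _∷_ (trans (ℤₚ.*-zeroʳ D) (sym (ℤₚ.*-zeroʳ (+ W)))) (zeros m)
  rebuild ((c , a) ∷ M) (c≥0 ∷ M≥0) ((τ , ratio , τ≤B) ∷ τs) with rebuild M M≥0 τs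
  ... | M′ , len , M′≤B , e = (τ , a) ∷ M′ , cong suc len , τ≤B ∷ M′≤B , extend (f a) _ _ e
    where
    Dτ≡cW : D * + τ ≡ c * + W
    Dτ≡cW = begin
      D * + τ                ≡⟨ cong (_* + τ) (ℤₚ.0≤i⇒+∣i∣≡i (ℤₚ.<⇒≤ D>0)) ⟨
      + ∣ D ∣ * + τ          ≡⟨ ℤₚ.pos-* ∣ D ∣ τ ⟨
      + (∣ D ∣ ℕ.* τ)        ≡⟨ cong (+_) ratio ⟩
      + (∣ c ∣ ℕ.* W)        ≡⟨ ℤₚ.pos-* ∣ c ∣ W ⟩
      + ∣ c ∣ * + W          ≡⟨ cong (_* + W) (ℤₚ.0≤i⇒+∣i∣≡i c≥0) ⟩
      c * + W ∎
    ring₁ : ∀ D τ x y → D * (τ * x + y) ≡ D * τ * x + D * y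
    ring₁ = solve-∀
    ring₂ : ∀ c W x z → c * W * x + W * z ≡ W * (c * x + z)
    ring₂ = solve-∀
    extend : ∀ {m} (x y z : Vec ℤ m) → D ⊡ y ≡ + W ⊡ z → D ⊡ (+ τ ⊡ x ⊞ y) ≡ + W ⊡ (c ⊡ x ⊞ z)
    extend [] [] [] _ = refl
    extend (x ∷ xs) (y ∷ ys) (z ∷ zs) e = cong₂ _∷_
      (begin
        D * (+ τ * x + y)            ≡⟨ ring₁ D (+ τ) x y ⟩
        D * + τ * x + D * y          ≡⟨ cong₂ (λ p q → p * x + q) Dτ≡cW (Vecₚ.∷-injectiveˡ e) ⟩
        c * + W * x + + W * z        ≡⟨ ring₂ c (+ W) x z ⟩
        + W * (c * x + z) ∎)
      (extend xs ys zs (Vecₚ.∷-injectiveʳ e))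
  rebuilt : _
  rebuilt = rebuild L L≥0 (All.tabulate (cramer f b t f≤b t≤b L D eq S))

-- Trades

lookup-ext : {A : Set} (u v : Vec A n) → (∀ i → lookup u i ≡ lookup v i) → u ≡ v
lookup-ext u v e = trans (sym (Vecₚ.tabulate∘lookup u)) (trans (Vecₚ.tabulate-cong e) (Vecₚ.tabulate∘lookup v))

bit : Bool → ℕ
bit b = if b then 1 else 0

excess : ∀ {j} → Fin n → Vec (Subset n) j → Vec (Subset n) j → ℤ
excess i Xs Ys = + occ i Xs - + occ i Ys

lookup-vec : (X Y : Subset n) (i : Fin n) → lookup (vec X Y) i ≡ + bit (lookup X i) - + bit (lookup Y i)
lookup-vec X Y i = begin
  lookup (vec X Y) i                          ≡⟨ Vecₚ.lookup-zipWith _-_ i (χ X) (χ Y) ⟩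
  lookup (χ X) i - lookup (χ Y) i             ≡⟨ cong₂ _-_ (lookup-χ X) (lookup-χ Y) ⟩
  + bit (lookup X i) - + bit (lookup Y i)     ∎
  where
  pos-bit : ∀ b → (if b then 1ℤ else 0ℤ) ≡ + bit b
  pos-bit true = refl
  pos-bit false = refl
  lookup-χ : ∀ Z → lookup (χ Z) i ≡ + bit (lookup Z i)
  lookup-χ Z = trans (Vecₚ.lookup-map i _ Z) (pos-bit (lookup Z i))

excess-∷ : ∀ {j} (i : Fin n) X Y (Xs Ys : Vec (Subset n) j) →
  excess i (X ∷ Xs) (Y ∷ Ys) ≡ lookup (vec X Y) i + excess i Xs Ys
excess-∷ i X Y Xs Ys = trans (ring (+ bit (lookup X i)) (+ occ i Xs) (+ bit (lookup Y i)) (+ occ i Ys))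
  (cong (_+ excess i Xs Ys) (sym (lookup-vec X Y i)))
  where
  ring : ∀ a b c d → (a + b) - (c + d) ≡ (a - c) + (b - d)
  ring = solve-∀

lookup-vsum : ∀ {j} (Xs Ys : Vec (Subset n) j) (i : Fin n) → lookup (vsum (Vec.zipWith vec Xs Ys)) i ≡ excess i Xs Ys
lookup-vsum [] [] i = Vecₚ.lookup-replicate i 0ℤ
lookup-vsum (X ∷ Xs) (Y ∷ Ys) i = begin
  lookup (Vec.zipWith _+_ (vec X Y) (vsum (Vec.zipWith vec Xs Ys))) i   ≡⟨ Vecₚ.lookup-zipWith _+_ i (vec X Y) _ ⟩
  lookup (vec X Y) i + lookup (vsum (Vec.zipWith vec Xs Ys)) i          ≡⟨ cong (λ z → lookup (vec X Y) i + z) (lookup-vsum Xs Ys i) ⟩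
  lookup (vec X Y) i + excess i Xs Ys                                   ≡⟨ excess-∷ i X Y Xs Ys ⟨
  excess i (X ∷ Xs) (Y ∷ Ys) ∎

lookup-term : (c : ℤ) (u v : Vec ℤ n) (i : Fin n) → lookup (c ⊡ u ⊞ v) i ≡ c * lookup u i + lookup v i
lookup-term c u v i = trans (Vecₚ.lookup-zipWith _+_ i (c ⊡ u) v) (cong (_+ lookup v i) (Vecₚ.lookup-map i (c *_) u))

module _ (G : SimpleGame n) where

  losing-⊆ : ∀ {X Y} → X ⊆ Y → Losing G Y → Losing G X
  losing-⊆ {X} {Y} X⊆Y lY with winning G X in eq
  ... | false = refl
  ... | true with () ← trans (sym lY) (monotone G X Y X⊆Y eq)

  full-winning : Winning G fullSet
  full-winning = let X , wX = someWin G in monotone G X fullSet (⊆-max X) wX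

  empty-losing : Losing G emptySet
  empty-losing = let Y , lY = someLose G in losing-⊆ (⊆-min Y) lY

  -- A losing side of a trade may shed players, so only an inequality between the occurrence counts is needed.
  shrink : ∀ {j} (Ys : Vec (Subset n) j) → VecAll.All (Losing G) Ys →
    (m : Fin n → ℕ) → (∀ i → m i ℕ.≤ occ i Ys) →
    ∃[ Ys′ ] VecAll.All (Losing G) {j} Ys′ × (∀ i → occ i Ys′ ≡ m i)
  shrink [] [] m m≤ = [] , [] , λ i → sym (ℕₚ.n≤0⇒n≡0 (m≤ i))
  shrink (Y ∷ Ys) (lY ∷ lYs) m m≤ =
    let Ys′ , lYs′ , count = shrink Ys lYs (λ i → proj₁ (proj₂ (choice i))) (λ i → proj₁ (proj₂ (proj₂ (proj₂ (choice i)))))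
    in Y′ ∷ Ys′ , losing-⊆ Y′⊆Y lY ∷ lYs′ , λ i →
         trans (cong₂ (λ b k → bit b ℕ.+ k) (Vecₚ.lookup∘tabulate (proj₁ ∘ choice) i) (count i))
               (proj₂ (proj₂ (proj₂ (proj₂ (choice i)))))
    where
    -- Greedy choice: a player stays in the current coalition only if the remaining ones contain
    -- that player fewer than `m` times. In that case `m` is exactly `1 + k`.
    split : ∀ b k m → m ℕ.≤ bit b ℕ.+ k →
      Σ Bool λ c → Σ ℕ λ m′ → (c ≡ true → b ≡ true) × m′ ℕ.≤ k × bit c ℕ.+ m′ ≡ m
    split false k m m≤k = false , m , (λ ()) , m≤k , refl
    split true k m m≤1+k with m ℕ.≤? k
    ... | yes m≤k = false , m , (λ ()) , m≤k , refl
    ... | no m≰k = true , k , (λ _ → refl) , ℕₚ.≤-refl , ℕₚ.≤-antisym (ℕₚ.≰⇒> m≰k) m≤1+k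
    choice : ∀ i → Σ Bool λ c → Σ ℕ λ m′ → (c ≡ true → lookup Y i ≡ true) × m′ ℕ.≤ occ i Ys × bit c ℕ.+ m′ ≡ m i
    choice i = split (lookup Y i) (occ i Ys) (m i) (m≤ i)
    Y′ : Subset n
    Y′ = tabulate (proj₁ ∘ choice)
    Y′⊆Y : Y′ ⊆ Y
    Y′⊆Y {i} i∈Y′ = Vecₚ.lookup⇒[]= i Y
      (proj₁ (proj₂ (proj₂ (choice i))) (trans (sym (Vecₚ.lookup∘tabulate (proj₁ ∘ choice) i)) (Vecₚ.[]=⇒lookup i∈Y′)))

  -- The trades of condition (b), before the pair (P, ∅) is adjoined to obtain a potent certificate.
  Deficient : ∀ {j} → Vec (Subset n) j → Vec (Subset n) j → Set
  Deficient Xs Ys = VecAll.All (Winning G) Xs × VecAll.All (Losing G) Ys × (∀ i → occ i Ys ≡ suc (occ i Xs))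

  deficient⇒potent : ∀ {j} (Xs Ys : Vec (Subset n) j) → Deficient Xs Ys →
    IsPotentCertificate G (fullSet ∷ Xs) (emptySet ∷ Ys)
  deficient⇒potent Xs Ys (wXs , lYs , def) =
    (trade , full-winning ∷ wXs , empty-losing ∷ lYs) , (zero , refl) , (zero , refl)
    where
    trade : IsTradingTransform (fullSet ∷ Xs) (emptySet ∷ Ys)
    trade i rewrite Vecₚ.lookup-replicate i true | Vecₚ.lookup-replicate i false = sym (def i)

  deficient⇒sum : ∀ {j} (Xs Ys : Vec (Subset n) j) → Deficient Xs Ys →
    Σ (Vec (Vec ℤ n) j) λ vs →
      VecAll.All (InI G) vs × Vec.zipWith _+_ (vsum vs) (replicate n 1ℤ) ≡ replicate n 0ℤ
  deficient⇒sum Xs Ys (wXs , lYs , def) = Vec.zipWith vec Xs Ys , members wXs lYs , lookup-ext _ _ λ i → begin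
    lookup (Vec.zipWith _+_ (vsum (Vec.zipWith vec Xs Ys)) (replicate n 1ℤ)) i  ≡⟨ Vecₚ.lookup-zipWith _+_ i (vsum (Vec.zipWith vec Xs Ys)) _ ⟩
    lookup (vsum (Vec.zipWith vec Xs Ys)) i + lookup (replicate n 1ℤ) i
      ≡⟨ cong₂ _+_ (lookup-vsum Xs Ys i) (Vecₚ.lookup-replicate i 1ℤ) ⟩
    + occ i Xs - + occ i Ys + 1ℤ                     ≡⟨ cong (λ k → + occ i Xs - + k + 1ℤ) (def i) ⟩
    + occ i Xs - (1ℤ + + occ i Xs) + 1ℤ              ≡⟨ ring (+ occ i Xs) ⟩
    0ℤ                                               ≡⟨ Vecₚ.lookup-replicate i 0ℤ ⟨
    lookup (replicate n 0ℤ) i ∎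
    where
    ring : ∀ a → a - (1ℤ + a) + 1ℤ ≡ 0ℤ
    ring = solve-∀
    members : ∀ {j} {Xs Ys : Vec (Subset n) j} → VecAll.All (Winning G) Xs → VecAll.All (Losing G) Ys →
      VecAll.All (InI G) (Vec.zipWith vec Xs Ys)
    members [] [] = []
    members (wX ∷ wXs) (lY ∷ lYs) = (_ , _ , wX , lY , refl) ∷ members wXs lYs

  -- Lets a violation of condition (b) be treated as a potent certificate: the coalitions behind
  -- each vector are recovered, and the equation is read player by player.
  sum⇒deficient : ∀ {j} (vs : Vec (Vec ℤ n) j) → VecAll.All (InI G) vs →
    Vec.zipWith _+_ (vsum vs) (replicate n 1ℤ) ≡ replicate n 0ℤ →
    ∃[ Xs ] ∃[ Ys ] Deficient {j} Xs Ys
  sum⇒deficient vs vs∈I sum≡0 with coalitions vs vs∈I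
    where
    coalitions : ∀ {j} (vs : Vec (Vec ℤ n) j) → VecAll.All (InI G) vs →
      ∃[ Xs ] ∃[ Ys ] VecAll.All (Winning G) {j} Xs × VecAll.All (Losing G) {j} Ys × vs ≡ Vec.zipWith vec Xs Ys
    coalitions [] [] = [] , [] , [] , [] , refl
    coalitions (v ∷ vs) ((X , Y , wX , lY , refl) ∷ vs∈I) with coalitions vs vs∈I
    ... | Xs , Ys , wXs , lYs , refl = X ∷ Xs , Y ∷ Ys , wX ∷ wXs , lY ∷ lYs , refl
  ... | Xs , Ys , wXs , lYs , refl = Xs , Ys , wXs , lYs , λ i → ℤₚ.+-injective (begin
    + occ i Ys                                       ≡⟨ ring (+ occ i Xs) (+ occ i Ys) ⟩
    1ℤ + + occ i Xs - (excess i Xs Ys + 1ℤ)          ≡⟨ cong (λ z → 1ℤ + + occ i Xs - z) (vanish i) ⟩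
    1ℤ + + occ i Xs - 0ℤ                             ≡⟨ ℤₚ.+-identityʳ _ ⟩
    + suc (occ i Xs) ∎)
    where
    ring : ∀ a b → b ≡ 1ℤ + a - (a - b + 1ℤ)
    ring = solve-∀
    vanish : ∀ i → excess i Xs Ys + 1ℤ ≡ 0ℤ
    vanish i = begin
      excess i Xs Ys + 1ℤ
        ≡⟨ cong₂ _+_ (lookup-vsum Xs Ys i) (Vecₚ.lookup-replicate i 1ℤ) ⟨
      lookup (vsum (Vec.zipWith vec Xs Ys)) i + lookup (replicate n 1ℤ) i
        ≡⟨ Vecₚ.lookup-zipWith _+_ i (vsum (Vec.zipWith vec Xs Ys)) _ ⟨
      lookup (Vec.zipWith _+_ (vsum (Vec.zipWith vec Xs Ys)) (replicate n 1ℤ)) i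
        ≡⟨ cong (λ v → lookup v i) sum≡0 ⟩
      lookup (replicate n 0ℤ) i ≡⟨ Vecₚ.lookup-replicate i 0ℤ ⟩
      0ℤ ∎

-- Generators of the cone, and the trades obtained from a small combination.

unit : Fin n → Vec ℤ n
unit zero = 1ℤ ∷ replicate _ 0ℤ
unit (suc i) = 0ℤ ∷ unit i

dot-unit : (w : Vec ℤ n) (i : Fin n) → dot w (unit i) ≡ lookup w i
dot-unit (x ∷ w) zero rewrite dot-zeroʳ w | ℤₚ.*-identityʳ x = ℤₚ.+-identityʳ x
dot-unit (x ∷ w) (suc i) rewrite ℤₚ.*-zeroʳ x = trans (ℤₚ.+-identityˡ _) (dot-unit w i)

lookup-unit≥0 : (k i : Fin n) → 0ℤ ≤ lookup (unit k) i
lookup-unit≥0 zero zero = +≤+ z≤n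
lookup-unit≥0 zero (suc i) = ℤₚ.≤-reflexive (sym (Vecₚ.lookup-replicate i 0ℤ))
lookup-unit≥0 (suc k) zero = ℤₚ.≤-refl
lookup-unit≥0 (suc k) (suc i) = lookup-unit≥0 k i

lookup-unit-self : (k : Fin n) → lookup (unit k) k ≡ 1ℤ
lookup-unit-self zero = refl
lookup-unit-self (suc k) = lookup-unit-self k

dot-vec≤ : (X Y : Subset n) → dot (vec X Y) (vec X Y) ≤ + n
dot-vec≤ [] [] = ℤₚ.≤-refl
dot-vec≤ (x ∷ X) (y ∷ Y) = ℤₚ.+-mono-≤ (square≤1 x y) (dot-vec≤ X Y)
  where
  d : Bool → Bool → ℤ
  d x y = (if x then 1ℤ else 0ℤ) - (if y then 1ℤ else 0ℤ)
  square≤1 : ∀ x y → d x y * d x y ≤ 1ℤ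
  square≤1 true true = +≤+ z≤n
  square≤1 true false = ℤₚ.≤-refl
  square≤1 false true = ℤₚ.≤-refl
  square≤1 false false = +≤+ z≤n

dot-minus-ones : ∀ n → dot (replicate n -1ℤ) (replicate n -1ℤ) ≡ + n
dot-minus-ones zero = refl
dot-minus-ones (suc n) = cong (λ z → 1ℤ + z) (dot-minus-ones n)

dot-χ : (w : Vec ℤ n) (X Y : Subset n) → dot w (vec X Y) ≡ dot w (χ X) - dot w (χ Y)
dot-χ [] [] [] = refl
dot-χ (x ∷ w) (b ∷ X) (c ∷ Y) rewrite dot-χ w X Y =
  ring x (if b then 1ℤ else 0ℤ) (if c then 1ℤ else 0ℤ) (dot w (χ X)) (dot w (χ Y))
  where
  ring : ∀ x b c p q → x * (b - c) + (p - q) ≡ x * b + p - (x * c + q)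
  ring = solve-∀

module _ (G : SimpleGame n) where

  Trade : Set
  Trade = Σ (Subset n) (Winning G) × Σ (Subset n) (Losing G)

  -- The unit vectors are present so that a functional nonnegative on all generators has nonnegative
  -- weights.
  generator : Trade ⊎ Fin n → Vec ℤ n
  generator (inj₁ ((X , _) , (Y , _))) = vec X Y
  generator (inj₂ i) = unit i

  generator-norm : 1 ℕ.≤ n → ∀ g → dot (generator g) (generator g) ≤ + n
  generator-norm _ (inj₁ ((X , _) , (Y , _))) = dot-vec≤ X Y
  generator-norm n≥1 (inj₂ i) = subst (_≤ + n) (sym (trans (dot-unit (unit i) i) (lookup-unit-self i))) (+≤+ n≥1)

  -- Each trade is repeated as often as its coefficient says, while the unit vectors are dropped.
  -- These have nonnegative entries, so dropping them can only lower the sum; hence an inequality in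
  -- `excess≤`.
  record Expansion (L : List (ℕ × (Trade ⊎ Fin n))) : Set where
    constructor expansion
    field
      size     : ℕ
      size≤    : size ℕ.≤ sum (List.map proj₁ L)
      winners  : Vec (Subset n) size
      losers   : Vec (Subset n) size
      winning′ : VecAll.All (Winning G) winners
      losing′  : VecAll.All (Losing G) losers
      excess≤  : ∀ i → excess i winners losers ≤ lookup (combination generator (List.map (map₁ (+_)) L)) i

  expand : ∀ L → Expansion L
  expand [] = expansion 0 z≤n [] [] [] [] (λ i → ℤₚ.≤-reflexive (sym (Vecₚ.lookup-replicate i 0ℤ)))
  expand ((τ , inj₂ k) ∷ L) with expand L
  ... | expansion j j≤ Xs Ys wXs lYs ex≤ = expansion j (ℕₚ.≤-trans j≤ (ℕₚ.m≤n+m _ τ)) Xs Ys wXs lYs λ i →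
    subst (excess i Xs Ys ≤_) (sym (lookup-term (+ τ) (unit k) (rest L) i))
      (subst (_≤ + τ * lookup (unit k) i + lookup (rest L) i) (ℤₚ.+-identityˡ _)
        (ℤₚ.+-mono-≤ (*-nonneg {+ τ} (+≤+ z≤n) (lookup-unit≥0 k i)) (ex≤ i)))
    where
    rest : List (ℕ × (Trade ⊎ Fin n)) → Vec ℤ n
    rest L = combination generator (List.map (map₁ (+_)) L)
  expand ((τ , inj₁ ((X , wX) , (Y , lY))) ∷ L) with expand L
  ... | expansion j j≤ Xs Ys wXs lYs ex≤ =
    expansion (τ ℕ.+ j) (ℕₚ.+-monoʳ-≤ τ j≤) (replicate τ X Vec.++ Xs) (replicate τ Y Vec.++ Ys)
      (many wX wXs τ) (many lY lYs τ) λ i →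
        subst₂ _≤_ (sym (excess-many i τ)) (sym (lookup-term (+ τ) (vec X Y) rest i))
          (ℤₚ.+-monoʳ-≤ (+ τ * lookup (vec X Y) i) (ex≤ i))
    where
    rest : Vec ℤ n
    rest = combination generator (List.map (map₁ (+_)) L)
    many : ∀ {P : Subset n → Set} {j Z} {Zs : Vec (Subset n) j} → P Z → VecAll.All P Zs →
      ∀ τ → VecAll.All P (replicate τ Z Vec.++ Zs)
    many p ps zero = ps
    many p ps (suc τ) = p ∷ many p ps τ
    excess-many : ∀ i τ → excess i (replicate τ X Vec.++ Xs) (replicate τ Y Vec.++ Ys) ≡
      + τ * lookup (vec X Y) i + excess i Xs Ys
    excess-many i zero = sym (ℤₚ.+-identityˡ _)
    excess-many i (suc τ) = begin
      excess i (X ∷ (replicate τ X Vec.++ Xs)) (Y ∷ (replicate τ Y Vec.++ Ys))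
        ≡⟨ excess-∷ i X Y (replicate τ X Vec.++ Xs) (replicate τ Y Vec.++ Ys) ⟩
      lookup (vec X Y) i + excess i (replicate τ X Vec.++ Xs) (replicate τ Y Vec.++ Ys)
        ≡⟨ cong (λ z → lookup (vec X Y) i + z) (excess-many i τ) ⟩
      lookup (vec X Y) i + (+ τ * lookup (vec X Y) i + excess i Xs Ys)
        ≡⟨ ring (+ τ) (lookup (vec X Y) i) (excess i Xs Ys) ⟩
      + suc τ * lookup (vec X Y) i + excess i Xs Ys ∎
      where
      ring : ∀ t v e → v + (t * v + e) ≡ (1ℤ + t) * v + e
      ring = solve-∀

  -- The number `m` is the largest of 1 and the coefficients, and serves as an integer stand-in for
  -- the square root of `B`.
  sum-bound : ∀ {B} → 1 ℕ.≤ B → (L : List (ℕ × (Trade ⊎ Fin n))) → All (λ x → proj₁ x ℕ.* proj₁ x ℕ.≤ B) L →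
    ∃[ m ] 1 ℕ.≤ m × m ℕ.* m ℕ.≤ B × sum (List.map proj₁ L) ℕ.≤ List.length L ℕ.* m
  sum-bound B≥1 [] [] = 1 , ℕₚ.≤-refl , B≥1 , z≤n
  sum-bound B≥1 ((τ , _) ∷ L) (τ≤B ∷ L≤B) with sum-bound B≥1 L L≤B
  ... | m , m≥1 , m≤B , sum≤ with ℕₚ.≤-total τ m
  ...   | inj₁ τ≤m = m , m≥1 , m≤B , ℕₚ.+-mono-≤ τ≤m sum≤
  ...   | inj₂ m≤τ = τ , ℕₚ.≤-trans m≥1 m≤τ , τ≤B ,
    ℕₚ.+-monoʳ-≤ τ (ℕₚ.≤-trans sum≤ (ℕₚ.*-monoʳ-≤ (List.length L) m≤τ))

  -- Since `m` is at least 1, `1 + n * m` is at most `(n + 1) * m`. The factor `n + 1` of the bound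
  -- thus leaves room for one further pair of coalitions.
  within-bound-suc : ∀ {j m} → 1 ℕ.≤ m → m ℕ.* m ℕ.≤ n ℕ.^ n → j ℕ.≤ n ℕ.* m → WithinBound n (suc j)
  within-bound-suc {j} {m} m≥1 m≤B j≤nm = ℕₚ.≤-trans (ℕₚ.*-mono-≤ 1+j≤ 1+j≤)
    (subst (ℕ._≤ (suc n ℕ.* suc n) ℕ.* (n ℕ.^ n)) (sym (ℕₚ.[m*n]*[o*p]≡[m*o]*[n*p] (suc n) m (suc n) m))
      (ℕₚ.*-monoʳ-≤ (suc n ℕ.* suc n) m≤B))
    where
    1+j≤ : suc j ℕ.≤ suc n ℕ.* m
    1+j≤ = ℕₚ.+-mono-≤ m≥1 j≤nm

  -- Every coordinate of the combination is `- W`, which is at most -1, so each player occurs more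
  -- often among the losers than among the winners; `shrink` makes the difference exactly one.
  -- Bounding `suc j` serves both conditions, as (a) requires the additional pair.
  small⇒deficient : 1 ℕ.≤ n → Small generator (replicate n -1ℤ) (n ℕ.^ n) →
    ∃[ j ] 1 ℕ.≤ j × WithinBound n (suc j) × ∃[ Xs ] ∃[ Ys ] Deficient G {j} Xs Ys
  small⇒deficient n≥1 (small L W W≥1 len bnd eq)
    with expand L | sum-bound (ℕₚ.m^n>0 n {{ℕ.>-nonZero n≥1}} n) L bnd
  ... | expansion j j≤ Xs Ys wXs lYs ex≤ | m , m≥1 , m≤B , sum≤ =
    let Ys′ , lYs′ , count = shrink G Ys lYs (λ i → suc (occ i Xs)) fewer
    in j , j≥1 n≥1 {Xs} Ys fewer , within-bound-suc m≥1 m≤B (ℕₚ.≤-trans j≤ (ℕₚ.≤-trans sum≤ (ℕₚ.*-monoˡ-≤ m len)))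
       , Xs , Ys′ , wXs , lYs′ , count
    where
    fewer : ∀ i → occ i Xs ℕ.< occ i Ys
    fewer i = ℤₚ.drop‿+≤+ (subst₂ _≤_ (ring₁ (+ occ i Xs) (+ occ i Ys)) (ring₂ (+ occ i Ys))
      (ℤₚ.+-monoˡ-≤ (1ℤ + + occ i Ys) excess≤-1))
      where
      ring₁ : ∀ a b → a - b + (1ℤ + b) ≡ 1ℤ + a
      ring₁ = solve-∀
      ring₂ : ∀ b → -1ℤ + (1ℤ + b) ≡ b
      ring₂ = solve-∀
      value : lookup (combination generator (List.map (map₁ (+_)) L)) i ≡ - + W
      value = begin
        lookup (combination generator (List.map (map₁ (+_)) L)) i ≡⟨ cong (λ v → lookup v i) eq ⟨
        lookup (+ W ⊡ replicate n -1ℤ) i                          ≡⟨ Vecₚ.lookup-map i (+ W *_) (replicate n -1ℤ) ⟩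
        + W * lookup (replicate n -1ℤ) i                          ≡⟨ cong (+ W *_) (Vecₚ.lookup-replicate i -1ℤ) ⟩
        + W * -1ℤ                                                 ≡⟨ ℤₚ.*-comm (+ W) -1ℤ ⟩
        -1ℤ * + W                                                 ≡⟨ ℤₚ.-1*i≡-i (+ W) ⟩
        - + W ∎
      excess≤-1 : excess i Xs Ys ≤ -1ℤ
      excess≤-1 = ℤₚ.≤-trans (ex≤ i) (ℤₚ.≤-trans (ℤₚ.≤-reflexive value) (ℤₚ.neg-mono-≤ (+≤+ W≥1)))
    -- With no coalitions at all, the first player would occur fewer than zero times. Generalising
    -- over `n` lets the match on `1 ≤ n` produce that player.
    j≥1 : ∀ {n j} → 1 ℕ.≤ n → {Xs : Vec (Subset n) j} (Ys : Vec (Subset n) j) → (∀ i → occ i Xs ℕ.< occ i Ys) → 1 ℕ.≤ j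
    j≥1 (s≤s _) [] lt with () ← lt zero
    j≥1 _ (_ ∷ _) _ = s≤s z≤n

-- Rough weights

<⇒≱ : ∀ {p q} → p ℚ.< q → ¬ (q ℚ.≤ p)
<⇒≱ p<q q≤p = ℚₚ.<-irrefl refl (ℚₚ.<-≤-trans p<q q≤p)

fromℤ-+ : ∀ i j → fromℤ (i + j) ≡ fromℤ i ℚ.+ fromℤ j
fromℤ-+ i j = ℚₚ.toℚᵘ-injective (ℚᵘₚ.≃-trans (ℚᵘ.*≡* (ring i j)) (ℚᵘₚ.≃-sym (ℚₚ.toℚᵘ-homo-+ (fromℤ i) (fromℤ j))))
  where
  ring : ∀ i j → (i + j) * 1ℤ ≡ (i * 1ℤ + j * 1ℤ) * 1ℤ
  ring = solve-∀

fromℤ-mono : ∀ {i j} → i ≤ j → fromℤ i ℚ.≤ fromℤ j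
fromℤ-mono {i} {j} le = ℚ.*≤* (subst₂ _≤_ (sym (ℤₚ.*-identityʳ i)) (sym (ℤₚ.*-identityʳ j)) le)

fromℤ-≢0 : ∀ {i} → i ≢ 0ℤ → fromℤ i ≢ 0ℚ
fromℤ-≢0 i≢0 e = i≢0 (cong ℚ.numerator e)

weight-fromℤ : (w : Vec ℤ n) (X : Subset n) → weight (Vec.map fromℤ w) X ≡ fromℤ (dot w (χ X))
weight-fromℤ [] [] = refl
weight-fromℤ (x ∷ w) (b ∷ X) = begin
  (if b then fromℤ x else 0ℚ) ℚ.+ weight (Vec.map fromℤ w) X            ≡⟨ cong₂ ℚ._+_ (head b) (weight-fromℤ w X) ⟩
  fromℤ (x * (if b then 1ℤ else 0ℤ)) ℚ.+ fromℤ (dot w (χ X))            ≡⟨ fromℤ-+ (x * (if b then 1ℤ else 0ℤ)) (dot w (χ X)) ⟨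
  fromℤ (x * (if b then 1ℤ else 0ℤ) + dot w (χ X)) ∎
  where
  head : ∀ b → (if b then fromℤ x else 0ℚ) ≡ fromℤ (x * (if b then 1ℤ else 0ℤ))
  head true = cong fromℤ (sym (ℤₚ.*-identityʳ x))
  head false = cong fromℤ (sym (ℤₚ.*-zeroʳ x))

subsets : ∀ n → List (Subset n)
subsets zero = [] ∷ []
subsets (suc n) = List.map (false ∷_) (subsets n) ++ List.map (true ∷_) (subsets n)

∈-subsets : (X : Subset n) → X ∈ subsets n
∈-subsets [] = here refl
∈-subsets (false ∷ X) = ∈-++⁺ˡ (∈-map⁺ (false ∷_) (∈-subsets X))
∈-subsets {suc n} (true ∷ X) = ∈-++⁺ʳ (List.map (false ∷_) (subsets n)) (∈-map⁺ (true ∷_) (∈-subsets X))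

sift : {A : Set} (p : A → Bool) (b : Bool) → List A → List (Σ A λ a → p a ≡ b)
sift p b [] = []
sift p b (a ∷ as) with p a Bool.≟ b
... | yes e = (a , e) ∷ sift p b as
... | no _ = sift p b as

∈-sift : {A : Set} (p : A → Bool) (b : Bool) {a : A} {as : List A} → a ∈ as → (e : p a ≡ b) → (a , e) ∈ sift p b as
∈-sift p b {a} (here {xs = as} refl) e with p a Bool.≟ b
-- The list holds the proof found by the decision, whereas `e` is arbitrary; uniqueness of identity
-- proofs equates them.
... | yes e′ = here (cong (a ,_) (uip e e′))
... | no ne = ⊥-elim (ne e)
∈-sift p b (there {x = a′} a∈) e with p a′ Bool.≟ b
... | yes _ = there (∈-sift p b a∈ e)
... | no _ = ∈-sift p b a∈ e

nonzero-entry : (w : Vec ℤ n) → w ≡ replicate n 0ℤ ⊎ ∃[ i ] lookup w i ≢ 0ℤ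
nonzero-entry [] = inj₁ refl
nonzero-entry (x ∷ w) with x ℤₚ.≟ 0ℤ | nonzero-entry w
... | no x≢0 | _ = inj₂ (zero , x≢0)
... | yes refl | inj₁ refl = inj₁ refl
... | yes refl | inj₂ (i , ne) = inj₂ (suc i , ne)

module _ (G : SimpleGame n) where

  winners : List (Σ (Subset n) (Winning G))
  winners = sift (winning G) true (subsets n)

  losers : List (Σ (Subset n) (Losing G))
  losers = sift (winning G) false (subsets n)

  generators : List (Trade G ⊎ Fin n)
  generators = List.map inj₁ (List.cartesianProduct winners losers) ++ List.map inj₂ (List.allFin n)

  ∈-generators : ∀ g → g ∈ generators
  ∈-generators (inj₁ ((X , wX) , (Y , lY))) = ∈-++⁺ˡ (∈-map⁺ inj₁ (∈-cartesianProduct⁺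
    (∈-sift (winning G) true (∈-subsets X) wX) (∈-sift (winning G) false (∈-subsets Y) lY)))
  ∈-generators (inj₂ i) = ∈-++⁺ʳ (List.map inj₁ (List.cartesianProduct winners losers)) (∈-map⁺ inj₂ (∈-allFin i))

  separated⇒rough : Separated (generator G) generators (replicate n -1ℤ) → RoughlyWeighted G
  separated⇒rough (w , w≥0 , wt<0) =
    Vec.map fromℤ w , fromℤ q , nonneg w (λ i → subst (0ℤ ≤_) (dot-unit w i) (All.lookup w≥0 (∈-generators (inj₂ i))))
    , inj₁ nontrivial , below , above
    where
    lightest : Σ (Subset n) (Winning G)
    -- The default `someWin G` is itself winning, so the minimum is attained at a winning coalition,
    -- which can be paired with any losing one to form a trade.
    lightest = argmin (λ (X , _) → dot w (χ X)) (someWin G) winners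
    q : ℤ
    q = dot w (χ (proj₁ lightest))
    winning≥q : ∀ {X} → Winning G X → fromℤ q ℚ.≤ weight (Vec.map fromℤ w) X
    winning≥q {X} wX = subst (fromℤ q ℚ.≤_) (sym (weight-fromℤ w X)) (fromℤ-mono
      (All.lookup (f[argmin]≤f[xs] {f = λ (X , _) → dot w (χ X)} (someWin G) winners)
        (∈-sift (winning G) true (∈-subsets X) wX)))
    losing≤q : ∀ {Y} → Losing G Y → weight (Vec.map fromℤ w) Y ℚ.≤ fromℤ q
    losing≤q {Y} lY = subst (ℚ._≤ fromℤ q) (sym (weight-fromℤ w Y)) (fromℤ-mono
      (ℤₚ.0≤i-j⇒j≤i (subst (0ℤ ≤_) (dot-χ w (proj₁ lightest) Y)
        (All.lookup w≥0 (∈-generators (inj₁ (lightest , (Y , lY))))))))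
    below : ∀ X → weight (Vec.map fromℤ w) X ℚ.< fromℤ q → Losing G X
    below X lt with winning G X in eq
    ... | false = refl
    ... | true = ⊥-elim (<⇒≱ lt (winning≥q eq))
    above : ∀ X → fromℤ q ℚ.< weight (Vec.map fromℤ w) X → Winning G X
    above X lt with winning G X in eq
    ... | true = refl
    ... | false = ⊥-elim (<⇒≱ lt (losing≤q eq))
    nonneg : ∀ {m} (u : Vec ℤ m) → (∀ i → 0ℤ ≤ lookup u i) → VecAll.All (ℚ.0ℚ ℚ.≤_) (Vec.map fromℤ u)
    nonneg [] _ = []
    nonneg (x ∷ u) h = fromℤ-mono (h zero) ∷ nonneg u (h ∘ suc)
    nontrivial : ∃[ i ] lookup (Vec.map fromℤ w) i ≢ 0ℚ
    nontrivial with nonzero-entry w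
    -- A zero `w` would give product zero with the vector of -1's, not a negative one.
    ... | inj₁ refl = ⊥-elim (ℤₚ.<-irrefl (trans (dot-comm _ (replicate n -1ℤ)) (dot-zeroʳ (replicate n -1ℤ))) wt<0)
    ... | inj₂ (i , ne) = i , λ e → fromℤ-≢0 ne (trans (sym (Vecₚ.lookup-map i fromℤ w)) e)

  rough⊎deficient : RoughlyWeighted G ⊎
    ∃[ j ] 1 ℕ.≤ j × WithinBound n (suc j) × ∃[ Xs ] ∃[ Ys ] Deficient G {j} Xs Ys
  rough⊎deficient with farkas (generator G) generators (replicate n -1ℤ)
  ... | inj₁ separated = inj₁ (separated⇒rough separated)
  ... | inj₂ b = inj₂ (small⇒deficient G n≥1
    (basic⇒small (generator G) n (replicate n -1ℤ) n≥1 (generator-norm G n≥1) (ℤₚ.≤-reflexive (dot-minus-ones n)) b))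
    where
    players : ∀ {n} → SimpleGame n → 1 ℕ.≤ n
    players {suc n} _ = s≤s z≤n
    -- Without players there is a single coalition, which cannot be both winning and losing.
    players {zero} G with someWin G | someLose G
    ... | [] , wX | [] , lY with () ← trans (sym wX) lY
    n≥1 : 1 ℕ.≤ n
    n≥1 = players G

-- Rough weights exclude potent certificates.

total : ∀ {j} → Vec ℚ n → Vec (Subset n) j → ℚ
total w [] = 0ℚ
total w (X ∷ Xs) = weight w X ℚ.+ total w Xs

total-∷ : ∀ {j} (x : ℚ) (w : Vec ℚ n) (Xs : Vec (Subset (suc n)) j) →
  total (x ∷ w) Xs ≡ occ zero Xs · x ℚ.+ total w (Vec.map Vec.tail Xs)
total-∷ x w [] = refl
total-∷ x w ((b ∷ X) ∷ Xs) = begin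
  (if b then x else 0ℚ) ℚ.+ weight w X ℚ.+ total (x ∷ w) Xs
    ≡⟨ cong ((if b then x else 0ℚ) ℚ.+ weight w X ℚ.+_) (total-∷ x w Xs) ⟩
  (if b then x else 0ℚ) ℚ.+ weight w X ℚ.+ (occ zero Xs · x ℚ.+ total w (Vec.map Vec.tail Xs))
    ≡⟨ interchange (if b then x else 0ℚ) _ _ _ ⟩
  (if b then x else 0ℚ) ℚ.+ occ zero Xs · x ℚ.+ (weight w X ℚ.+ total w (Vec.map Vec.tail Xs))
    ≡⟨ cong (ℚ._+ (weight w X ℚ.+ total w (Vec.map Vec.tail Xs))) (head b) ⟩
  occ zero ((b ∷ X) ∷ Xs) · x ℚ.+ total w (Vec.map Vec.tail ((b ∷ X) ∷ Xs)) ∎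
  where
  head : ∀ b → (if b then x else 0ℚ) ℚ.+ occ zero Xs · x ≡ occ zero ((b ∷ X) ∷ Xs) · x
  head true = refl
  head false = ℚₚ.+-identityˡ _

occ-tail : ∀ {j} (i : Fin n) (Xs : Vec (Subset (suc n)) j) → occ i (Vec.map Vec.tail Xs) ≡ occ (suc i) Xs
occ-tail i [] = refl
occ-tail i ((b ∷ X) ∷ Xs) = cong (bit (lookup X i) ℕ.+_) (occ-tail i Xs)

-- The total depends only on how often each player occurs, as is seen by splitting off one player at
-- a time with `total-∷`.
total-trade : ∀ {j} (w : Vec ℚ n) (Xs Ys : Vec (Subset n) j) → IsTradingTransform Xs Ys → total w Xs ≡ total w Ys
total-trade [] Xs Ys _ = trans (total-[] Xs) (sym (total-[] Ys))
  where
  total-[] : ∀ {j} (Zs : Vec (Subset 0) j) → total [] Zs ≡ 0ℚ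
  total-[] [] = refl
  total-[] ([] ∷ Zs) = trans (ℚₚ.+-identityˡ _) (total-[] Zs)
total-trade (x ∷ w) Xs Ys trade = begin
  total (x ∷ w) Xs                                            ≡⟨ total-∷ x w Xs ⟩
  occ zero Xs · x ℚ.+ total w (Vec.map Vec.tail Xs)
    ≡⟨ cong₂ (λ k t → k · x ℚ.+ t) (trade zero) (total-trade w (Vec.map Vec.tail Xs) (Vec.map Vec.tail Ys)
         (λ i → trans (occ-tail i Xs) (trans (trade (suc i)) (sym (occ-tail i Ys))))) ⟩
  occ zero Ys · x ℚ.+ total w (Vec.map Vec.tail Ys)           ≡⟨ total-∷ x w Ys ⟨
  total (x ∷ w) Ys ∎

-- Stated for an arbitrary compatible relation so as to cover both ≤ (for winning) and ≥ (for losing coalitions).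
module _ (_≲_ : ℚ → ℚ → Set) (≲-refl : ∀ {p} → p ≲ p)
         (≲-trans : ∀ {p q r} → p ≲ q → q ≲ r → p ≲ r)
         (≲-mono : ∀ {p q r s} → p ≲ q → r ≲ s → (p ℚ.+ r) ≲ (q ℚ.+ s)) where

  total-bound : ∀ {j} (w : Vec ℚ n) (q : ℚ) {Xs : Vec (Subset n) j} →
    VecAll.All (λ X → q ≲ weight w X) Xs → (j · q) ≲ total w Xs
  total-bound w q [] = ≲-refl
  total-bound w q (le ∷ les) = ≲-mono le (total-bound w q les)

  -- All summands except the `k`-th are compared with `q`. The extra `q` on the right replaces the
  -- factor `j - 1` that would otherwise appear on the left.
  total-bound-at : ∀ {j} (w : Vec ℚ n) (q : ℚ) {Xs : Vec (Subset n) j} → VecAll.All (λ X → q ≲ weight w X) Xs →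
    (k : Fin j) {Z : Subset n} → lookup Xs k ≡ Z → (weight w Z ℚ.+ j · q) ≲ (q ℚ.+ total w Xs)
  total-bound-at {j = suc j} w q {X ∷ Xs} (_ ∷ les) zero refl =
    subst (_≲ (q ℚ.+ total w (X ∷ Xs))) (x∙yz≈y∙xz q (weight w X) (j · q))
      (≲-mono {q} ≲-refl (≲-mono {weight w X} ≲-refl (total-bound w q les)))
  total-bound-at {j = suc j} w q {X ∷ Xs} (le ∷ les) (suc k) {Z} eq =
    subst (_≲ (q ℚ.+ total w (X ∷ Xs))) (x∙yz≈y∙xz q (weight w Z) (j · q))
      (≲-mono {q} ≲-refl (≲-trans (total-bound-at w q les k eq) (≲-mono le ≲-refl)))

weight-empty : (w : Vec ℚ n) → weight w emptySet ≡ 0ℚ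
weight-empty [] = refl
weight-empty (x ∷ w) = trans (ℚₚ.+-identityˡ _) (weight-empty w)

weight-full≥0 : (w : Vec ℚ n) → VecAll.All (0ℚ ℚ.≤_) w → 0ℚ ℚ.≤ weight w fullSet
weight-full≥0 [] [] = ℚₚ.≤-refl
weight-full≥0 (x ∷ w) (x≥0 ∷ w≥0) = subst (ℚ._≤ x ℚ.+ weight w fullSet) (ℚₚ.+-identityˡ 0ℚ)
  (ℚₚ.+-mono-≤ x≥0 (weight-full≥0 w w≥0))

lookup≤weight-full : (w : Vec ℚ n) → VecAll.All (0ℚ ℚ.≤_) w → ∀ i → lookup w i ℚ.≤ weight w fullSet
lookup≤weight-full (x ∷ w) (x≥0 ∷ w≥0) zero = subst (ℚ._≤ x ℚ.+ weight w fullSet) (ℚₚ.+-identityʳ x)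
  (ℚₚ.+-monoʳ-≤ x (weight-full≥0 w w≥0))
lookup≤weight-full (x ∷ w) (x≥0 ∷ w≥0) (suc i) = subst (ℚ._≤ x ℚ.+ weight w fullSet) (ℚₚ.+-identityˡ (lookup w i))
  (ℚₚ.+-mono-≤ x≥0 (lookup≤weight-full w w≥0 i))

-- Both totals agree, so comparing all coalitions other than the grand and the empty one with `q`
-- gives `weight w fullSet ≤ weight w emptySet`, which is zero. Hence all weights vanish, and `q`
-- vanishes too, lying between the weight of a losing and that of a winning coalition. The length
-- `j` is arbitrary.
rough⇒¬potent : (G : SimpleGame n) → RoughlyWeighted G →
  ∀ {j} (Xs Ys : Vec (Subset n) j) → ¬ IsPotentCertificate G Xs Ys
rough⇒¬potent {n} G (w , q , w≥0 , nontrivial , below , above) {j} Xs Ys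
  ((trade , wXs , lYs) , (k , k-full) , (l , l-empty)) = contradiction nontrivial
  where
  winning≥q : ∀ {X} → Winning G X → q ℚ.≤ weight w X
  winning≥q {X} wX = ℚₚ.≮⇒≥ λ lt → case (trans (sym wX) (below X lt))
    where
    case : true ≢ false
    case ()
  losing≤q : ∀ {Y} → Losing G Y → weight w Y ℚ.≤ q
  losing≤q {Y} lY = ℚₚ.≮⇒≥ λ lt → case (trans (sym lY) (above Y lt))
    where
    case : false ≢ true
    case ()
  full≤empty : weight w fullSet ℚ.≤ weight w emptySet
  full≤empty = ℚₚ.≮⇒≥ λ lt → <⇒≱ (ℚₚ.+-monoˡ-< (j · q) lt) (
    ℚₚ.≤-trans (total-bound-at ℚ._≤_ ℚₚ.≤-refl ℚₚ.≤-trans ℚₚ.+-mono-≤ w q (VecAll.map winning≥q wXs) k k-full)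
      (subst (λ t → q ℚ.+ t ℚ.≤ weight w emptySet ℚ.+ j · q) (sym (total-trade w Xs Ys trade))
        (total-bound-at (flip ℚ._≤_) ℚₚ.≤-refl (flip ℚₚ.≤-trans) ℚₚ.+-mono-≤ w q (VecAll.map losing≤q lYs) l l-empty)))
  full≤0 : weight w fullSet ℚ.≤ 0ℚ
  full≤0 = subst (weight w fullSet ℚ.≤_) (weight-empty w) full≤empty
  contradiction : (∃[ i ] lookup w i ≢ 0ℚ) ⊎ q ≢ 0ℚ → ⊥
  contradiction (inj₁ (i , wi≢0)) = wi≢0 (ℚₚ.≤-antisym
    (ℚₚ.≤-trans (lookup≤weight-full w w≥0 i) full≤0) (VecAllₚ.lookup⁺ w≥0 i))
  contradiction (inj₂ q≢0) = q≢0 (ℚₚ.≤-antisym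
    (ℚₚ.≤-trans (winning≥q (full-winning G)) full≤0)
    (subst (ℚ._≤ q) (weight-empty w) (losing≤q (empty-losing G))))

theorem7 : (n : ℕ) (G : SimpleGame n) →
    (ConditionA G ⇔ ConditionB G) × (RoughlyWeighted G ⇔ ConditionA G) × (RoughlyWeighted G ⇔ ConditionB G)
theorem7 n G = mk⇔ (rough⇒B ∘ A⇒rough) (rough⇒A ∘ B⇒rough) , mk⇔ rough⇒A A⇒rough , mk⇔ rough⇒B B⇒rough
  where
  rough⇒A : RoughlyWeighted G → ConditionA G
  rough⇒A rough j _ _ (Xs , Ys , potent) = rough⇒¬potent G rough Xs Ys potent
  rough⇒B : RoughlyWeighted G → ConditionB G
  rough⇒B rough j _ _ (vs , vs∈I , sum≡0) =
    -- Adjoining the pair may push the length past the bound; this is harmless because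
    -- `rough⇒¬potent` holds for every length.
    let Xs , Ys , def = sum⇒deficient G vs vs∈I sum≡0
    in rough⇒¬potent G rough (fullSet ∷ Xs) (emptySet ∷ Ys) (deficient⇒potent G Xs Ys def)
  A⇒rough : ConditionA G → RoughlyWeighted G
  A⇒rough noPotent with rough⊎deficient G
  ... | inj₁ rough = rough
  ... | inj₂ (j , _ , within , Xs , Ys , def) =
    ⊥-elim (noPotent (suc j) (s≤s z≤n) within (_ , _ , deficient⇒potent G Xs Ys def))
  B⇒rough : ConditionB G → RoughlyWeighted G
  B⇒rough noSum with rough⊎deficient G
  ... | inj₁ rough = rough
  ... | inj₂ (j , j≥1 , within , Xs , Ys , def) =
    ⊥-elim (noSum j j≥1 (ℕₚ.≤-trans (ℕₚ.*-mono-≤ (ℕₚ.n≤1+n j) (ℕₚ.n≤1+n j)) within) (deficient⇒sum G Xs Ys def))
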